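{- Let $q$ be an odd prime power. For all $u,v\in\mathbb{F}_q$ with $u\neq v$ and all integers $n\ge 2$, $$|C_{u,v}(n)|-|D_{u,v}(n)|=\begin{cases}0, & \text{if } 2\nmid n,\\ |C_{u,v}(n/2)|, & \text{if } 2\mid n.\end{cases}$$
   Context: $\mathcal{I}_q^n$ denotes the set of monic irreducible polynomials of degree $n$ in $\mathbb{F}_q[x]$. For $a\in\mathbb{F}_q$ write $\left(\frac{a}{q}\right)=a^{(q-1)/2}$, which for $a\neq 0$ equals $1$ if $a$ is a square in $\mathbb{F}_q^{\ast}$ and $-1$ otherwise (and equals $0$ for $a=0$). For $n\ge 1$, $$C_{u,v}(n):=\left\{f\in\mathcal{I}_q^n\;\middle|\; \left(\tfrac{f(u)f(v)}{q}\right)=-1\right\},$$ and for $n\ge 2$, $D_{u,v}(n):=\mathcal{I}_q^n\setminus C_{u,v}(n)=\left\{f\in\mathcal{I}_q^n\mid \left(\tfrac{f(u)f(v)}{q}\right)=1\right\}$. -}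

module Defs where

open import Level using (Level; _⊔_) renaming (suc to lsuc)
open import Algebra.Bundles using (CommutativeRing; RawSemiring)
open import Data.Fin.Base using (Fin)
open import Data.List.Base using (List; []; _∷_; map; foldr)
open import Data.Nat.Base as ℕ using (ℕ; zero; suc; _∸_; _/_)
open import Data.Nat.Divisibility using (_∤_)
open import Data.Nat.Primality using (Prime)
open import Data.Product.Base using (Σ; ∃; ∃₂; _×_; proj₁)
open import Function.Bundles using (Inverse)
open import Relation.Binary.Bundles using (Setoid)
open import Relation.Binary.PropositionalEquality using (_≡_)
import Relation.Binary.PropositionalEquality.Properties as ≡
import Relation.Binary.Construct.On as On
open import Relation.Nullary.Negation.Core using (¬_)
open import Relation.Unary using (Pred; _∩_; _∖_)
import Algebra.Definitions.RawSemiring as RawSemiringDefs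
import Algebra.Properties.Semiring.Exp as SemiringExp

OddPrimePower : ℕ → Set
OddPrimePower q = (∃₂ λ p k → Prime p × 1 ℕ.≤ k × q ≡ p ℕ.^ k) × 2 ∤ q

-- The setoid S has exactly n elements up to its equality.
HasSize : ∀ {a ℓ} → Setoid a ℓ → ℕ → Set (a ⊔ ℓ)
HasSize S n = Inverse S (≡.setoid (Fin n))

-- The elements of S satisfying P are counted up to the equality of S,
-- irrespective of the proofs of P.
HasCardinality : ∀ {a ℓ p} (S : Setoid a ℓ) →
                 Pred (Setoid.Carrier S) p → ℕ → Set (a ⊔ ℓ ⊔ p)
HasCardinality S P = HasSize (On.setoid {B = Σ (Setoid.Carrier S) P} S proj₁)

record FiniteField (q : ℕ) (c ℓ : Level) : Set (lsuc (c ⊔ ℓ)) where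
  field
    commutativeRing : CommutativeRing c ℓ
  open CommutativeRing commutativeRing public
  field
    0≉1     : ¬ 0# ≈ 1#
    inverse : ∀ x → ¬ x ≈ 0# → ∃ λ y → x * y ≈ 1#
    size    : HasSize setoid q

module Polynomial {c ℓ} (R : CommutativeRing c ℓ) where
  open CommutativeRing R

  -- Coefficient lists, constant term first. Trailing zeros are allowed, so
  -- polynomials are compared by their coefficients.
  Poly : Set c
  Poly = List Carrier

  coeff : Poly → ℕ → Carrier
  coeff []      _       = 0#
  coeff (a ∷ _) zero    = a
  coeff (_ ∷ f) (suc i) = coeff f i

  infix 4 _≈ₚ_
  _≈ₚ_ : Poly → Poly → Set ℓ
  f ≈ₚ g = ∀ i → coeff f i ≈ coeff g i

  polySetoid : Setoid c ℓ
  polySetoid = record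
    { Carrier = Poly
    ; _≈_     = _≈ₚ_
    ; isEquivalence = record
      { refl  = λ i → refl
      ; sym   = λ p i → sym (p i)
      ; trans = λ p r i → trans (p i) (r i)
      }
    }

  infixl 6 _+ₚ_
  _+ₚ_ : Poly → Poly → Poly
  []      +ₚ g       = g
  (a ∷ f) +ₚ []      = a ∷ f
  (a ∷ f) +ₚ (b ∷ g) = (a + b) ∷ (f +ₚ g)

  infixl 7 _*ₚ_
  _*ₚ_ : Poly → Poly → Poly
  []      *ₚ g = []
  (a ∷ f) *ₚ g = map (a *_) g +ₚ (0# ∷ (f *ₚ g))

  polyRawSemiring : RawSemiring c ℓ
  polyRawSemiring = record
    { Carrier = Poly
    ; _≈_     = _≈ₚ_
    ; _+_     = _+ₚ_
    ; _*_     = _*ₚ_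
    ; 0#      = []
    ; 1#      = 1# ∷ []
    }

  open RawSemiringDefs polyRawSemiring public using (Irreducible)

  eval : Poly → Carrier → Carrier
  eval f x = foldr (λ a r → a + x * r) 0# f

  MonicOfDegree : ℕ → Pred Poly ℓ
  MonicOfDegree n f = coeff f n ≈ 1# × (∀ i → n ℕ.< i → coeff f i ≈ 0#)

module _ {q : ℕ} {c ℓ} (𝔽 : FiniteField q c ℓ) where
  open FiniteField 𝔽
  open Polynomial commutativeRing
  open SemiringExp semiring using (_^_)

  -- The quadratic character, with values in the field itself.
  legendre : Carrier → Carrier
  legendre a = a ^ ((q ∸ 1) / 2)

  𝓘 : ℕ → Pred Poly (c ⊔ ℓ)
  𝓘 n = MonicOfDegree n ∩ Irreducible

  C : Carrier → Carrier → ℕ → Pred Poly (c ⊔ ℓ)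
  C u v n = 𝓘 n ∩ λ f → legendre (eval f u * eval f v) ≈ - 1#

  D : Carrier → Carrier → ℕ → Pred Poly (c ⊔ ℓ)
  D u v n = 𝓘 n ∖ C u v n

  PolyCard : Pred Poly (c ⊔ ℓ) → ℕ → Set (c ⊔ ℓ)
  PolyCard = HasCardinality polySetoid

{-# OPTIONS --safe #-}

-- Let χ(f) = (f(u) f(v) / q), a completely multiplicative function on monic polynomials.
-- Its L-series Σ_f χ(f) T^deg f is 1 - T, because multiplying the value at u alone by a
-- non-residue permutes the monic polynomials of any degree ≥ 2. Sieving out the irreducibles
-- of degree at most m, one at a time, multiplies the series by 1 - χ(P) T^deg P each, which only
-- needs Euclid's lemma; by (1 - T^d)(1 + T^d) = 1 - T^2d and induction on m ≥ 1 the result is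
-- the product of (1 - T^2d)^|C(d)| over m/2 < d ≤ m. Its coefficient at T^(m+1), which is
-- |D(m+1)| - |C(m+1)|, is therefore 0 or -|C((m+1)/2)|.
module Submission where

open import Defs
open import Algebra.Bundles using (CommutativeMonoid; CommutativeRing)
import Algebra.Properties.CommutativeMonoid.Mult as CommutativeMonoidMult
import Algebra.Properties.CommutativeSemiring.Exp as Exp
import Algebra.Properties.Ring as RingProperties
import Algebra.Solver.Ring.NaturalCoefficients.Default as RingSolver
open import Data.Fin.Base using (Fin)
open import Data.Fin.Properties using () renaming (_≟_ to _≟ᶠ_)
open import Data.Integer.Base as ℤ using (ℤ; +_; 0ℤ; 1ℤ; -1ℤ)
import Data.Integer.Properties as ℤₚ
open import Data.Integer.Tactic.RingSolver using (solve-∀)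
open import Data.List.Base using (List; []; _∷_; _++_; cartesianProductWith; filter; foldr; length; lookup; map; replicate; tabulate)
import Data.List.Membership.Setoid as Membership
import Data.List.Membership.Setoid.Properties as Membershipₚ
import Data.List.Properties as List
import Data.List.Relation.Binary.Permutation.Homogeneous as Homogeneous
import Data.List.Relation.Binary.Permutation.Setoid as Permutation
import Data.List.Relation.Binary.Permutation.Setoid.Properties as Permutationₚ
open import Data.List.Relation.Binary.Pointwise using (Pointwise; []; _∷_)
open import Data.List.Relation.Unary.All as All using (All; []; _∷_; all?)
import Data.List.Relation.Unary.All.Properties as Allₚ
open import Data.List.Relation.Unary.AllPairs using ([]; _∷_)
open import Data.List.Relation.Unary.Any as Any using (here; there)
import Data.List.Relation.Unary.Any.Properties as Anyₚ
import Data.List.Relation.Unary.Unique.Setoid as Unique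
import Data.List.Relation.Unary.Unique.Setoid.Properties as Uniqueₚ
open import Data.Nat.Base as ℕ using (ℕ; zero; suc; z≤n; s≤s; _≤_; _∸_; _/_; _%_)
open import Data.Nat.Divisibility using (_∣_; _∤_; divides; m%n≡0⇒n∣m)
open import Data.Nat.DivMod using (m≡m%n+[m/n]*n; m%n<n; m*n/n≡m)
import Data.Nat.Properties as ℕₚ
open import Data.Product.Base using (∃; ∃₂; _×_; _,_; proj₁; proj₂)
open import Data.Sum.Base using (_⊎_; inj₁; inj₂)
open import Function.Bundles using (Inverse)
open import Relation.Binary.Bundles using (Setoid)
open import Relation.Binary.Definitions using (Decidable; tri<; tri≈; tri>)
open import Relation.Binary.PropositionalEquality as ≡ using (_≡_; _≗_; cong; cong₂)
import Relation.Binary.Reasoning.Setoid as ≈-Reasoning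
open import Relation.Nullary.Decidable.Core using (Dec; yes; no; ¬?; map′; _×-dec_)
open import Relation.Nullary.Negation.Core using (¬_; contradiction)
open import Relation.Unary using (Pred) renaming (Decidable to Decidable₁)

-- Only the coefficient at T ^ (m + 1) is read after sieving the degrees up to m. There a monic
-- polynomial without a sieved factor is irreducible, so neither unique factorisation nor an
-- infinite product is involved.
--
-- The induction turns on a balance. In degree d the |C(d)| factors 1 + T ^ d need as many partners
-- 1 - T ^ d. The irreducibles with χ = 1 supply some of them. The shortfall is exactly what is left
-- over from degree d / 2, namely (1 - T ^ d) ^ |C(d / 2)|, or for d = 1 the L-series 1 - T itself.
--
-- The permutation behind the L-series adds a multiple of x - v, which would spoil the leading
-- coefficient in degree 1. That coefficient is computed directly as the sum of σ(b (b + w)) over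
-- the field with w = v - u ≠ 0, which is -1.
--
-- Two points concern χ itself. It takes values in ℤ, because sums inside the field would be known
-- only modulo the characteristic. It vanishes at an irreducible only for x - u and x - v, so from
-- degree 2 on the complement of C is exactly χ = 1.

-- Integer sums and duplicate-free lists over a setoid

module _ {a} {A : Set a} where

  Σ[_] : (A → ℤ) → List A → ℤ
  Σ[ w ] []       = 0ℤ
  Σ[ w ] (x ∷ xs) = w x ℤ.+ Σ[ w ] xs

  Σ-cong : ∀ {w w′} xs → All (λ x → w x ≡ w′ x) xs → Σ[ w ] xs ≡ Σ[ w′ ] xs
  Σ-cong []       []       = ≡.refl
  Σ-cong (x ∷ xs) (e ∷ es) = cong₂ ℤ._+_ e (Σ-cong xs es)

  Σ-*ˡ : ∀ k w xs → Σ[ (λ x → k ℤ.* w x) ] xs ≡ k ℤ.* Σ[ w ] xs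
  Σ-*ˡ k w []       = ≡.sym (ℤₚ.*-zeroʳ k)
  Σ-*ˡ k w (x ∷ xs) = begin
    k ℤ.* w x ℤ.+ Σ[ (λ x → k ℤ.* w x) ] xs ≡⟨ cong (ℤ._+_ (k ℤ.* w x)) (Σ-*ˡ k w xs) ⟩
    k ℤ.* w x ℤ.+ k ℤ.* Σ[ w ] xs           ≡⟨ ℤₚ.*-distribˡ-+ k _ _ ⟨
    k ℤ.* (w x ℤ.+ Σ[ w ] xs)               ∎
    where open ≡.≡-Reasoning

Σ-map : ∀ {a b} {A : Set a} {B : Set b} (w : B → ℤ) (φ : A → B) xs →
        Σ[ w ] (map φ xs) ≡ Σ[ (λ x → w (φ x)) ] xs
Σ-map w φ []       = ≡.refl
Σ-map w φ (x ∷ xs) = cong (ℤ._+_ (w (φ x))) (Σ-map w φ xs)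

module UniqueLists {a ℓ} (S : Setoid a ℓ) where

  open Setoid S renaming (Carrier to A)
  open Membership S using (_∈_)
  open Permutation S using (_↭_; ↭-refl; ↭-sym; ↭-trans; ↭-prep; ↭-swap)
  open Permutationₚ S using (xs↭ys⇒|xs|≡|ys|)
  open Unique S using (Unique)

  ∈⇒↭∷ : ∀ {x} ys → x ∈ ys → ∃ λ zs → ys ↭ x ∷ zs
  ∈⇒↭∷ (y ∷ ys) (here x≈y) = ys , ↭-prep-≈ (sym x≈y)
    where
    ↭-prep-≈ : ∀ {x y zs} → x ≈ y → x ∷ zs ↭ y ∷ zs
    ↭-prep-≈ e = Homogeneous.prep e ↭-refl
  ∈⇒↭∷ (y ∷ ys) (there x∈ys) with ∈⇒↭∷ ys x∈ys
  ... | zs , p = y ∷ zs , ↭-trans (↭-prep y p) (↭-swap y _ ↭-refl)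

  ∈-∷⁻ : ∀ {x y zs} → ¬ x ≈ y → x ∈ y ∷ zs → x ∈ zs
  ∈-∷⁻ x≉y (here x≈y)   = contradiction x≈y x≉y
  ∈-∷⁻ x≉y (there x∈zs) = x∈zs

  -- Each entry of `xs` is pulled out of `ys` in turn. The later entries differ from it, so they
  -- remain in what is left.
  unique-⊆⇒↭++ : ∀ {xs ys} → Unique xs → All (_∈ ys) xs → ∃ λ zs → ys ↭ xs ++ zs
  unique-⊆⇒↭++ {[]}     {ys} [] [] = ys , ↭-refl
  unique-⊆⇒↭++ {x ∷ xs} {ys} (x∉xs ∷ xs!) (x∈ys ∷ xs⊆ys)
    with ys′ , p ← ∈⇒↭∷ ys x∈ys
    with zs , q ← unique-⊆⇒↭++ {xs} {ys′} xs!
      (All.zipWith (λ (x≉y , y∈ys) →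
          ∈-∷⁻ (λ y≈x → x≉y (sym y≈x)) (Permutationₚ.∈-resp-↭ S p y∈ys))
        (x∉xs , xs⊆ys))
    = zs , ↭-trans p (↭-prep x q)

  -- The pigeonhole principle: a nonempty surplus `zs` would make `ys` longer than `xs`. It makes an
  -- injective self-map of a finite list a permutation without any argument for surjectivity.
  unique-⊆∧length⇒↭ : ∀ {xs ys} → Unique xs → All (_∈ ys) xs →
                      length ys ℕ.≤ length xs → xs ↭ ys
  unique-⊆∧length⇒↭ {xs} {ys} xs! xs⊆ys ys≤xs with unique-⊆⇒↭++ xs! xs⊆ys
  ... | [] , p = ↭-sym (≡.subst (ys ↭_) (List.++-identityʳ xs) p)
  ... | z ∷ zs , p = contradiction ys≤xs (ℕₚ.<⇒≱ (begin-strict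
    length xs                    <⟨ ℕₚ.m<m+n (length xs) (s≤s z≤n) ⟩
    length xs ℕ.+ suc (length zs) ≡⟨ List.length-++ xs ⟨
    length (xs ++ z ∷ zs)        ≡⟨ xs↭ys⇒|xs|≡|ys| p ⟨
    length ys                    ∎))
    where open ℕₚ.≤-Reasoning

  unique-⊆⇒length≤ : ∀ {xs ys} → Unique xs → All (_∈ ys) xs → length xs ℕ.≤ length ys
  unique-⊆⇒length≤ {xs} {ys} xs! xs⊆ys with zs , p ← unique-⊆⇒↭++ xs! xs⊆ys = begin
    length xs                ≤⟨ ℕₚ.m≤m+n _ _ ⟩
    length xs ℕ.+ length zs  ≡⟨ List.length-++ xs ⟨
    length (xs ++ zs)        ≡⟨ xs↭ys⇒|xs|≡|ys| p ⟨
    length ys                ∎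
    where open ℕₚ.≤-Reasoning

  unique-⊆-⊇⇒↭ : ∀ {xs ys} → Unique xs → Unique ys →
                 All (_∈ ys) xs → All (_∈ xs) ys → xs ↭ ys
  unique-⊆-⊇⇒↭ xs! ys! xs⊆ys ys⊆xs =
    unique-⊆∧length⇒↭ xs! xs⊆ys (unique-⊆⇒length≤ ys! ys⊆xs)

  Σ-↭ : (w : A → ℤ) → (∀ {x y} → x ≈ y → w x ≡ w y) →
        ∀ {xs ys} → xs ↭ ys → Σ[ w ] xs ≡ Σ[ w ] ys
  Σ-↭ w w-cong (Homogeneous.refl xs≋ys) = go xs≋ys
    where
    go : ∀ {xs ys} → Pointwise _≈_ xs ys → Σ[ w ] xs ≡ Σ[ w ] ys
    go []       = ≡.refl
    go (e ∷ es) = cong₂ ℤ._+_ (w-cong e) (go es)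
  Σ-↭ w w-cong (Homogeneous.prep e p) = cong₂ ℤ._+_ (w-cong e) (Σ-↭ w w-cong p)
  Σ-↭ w w-cong (Homogeneous.swap {xs} {ys} {x} {y} {x′} {y′} e₁ e₂ p) = begin
    w x ℤ.+ (w y ℤ.+ Σ[ w ] xs)    ≡⟨ ℤₚ.+-assoc (w x) _ _ ⟨
    w x ℤ.+ w y ℤ.+ Σ[ w ] xs      ≡⟨ cong (ℤ._+ _) (ℤₚ.+-comm (w x) (w y)) ⟩
    w y ℤ.+ w x ℤ.+ Σ[ w ] xs      ≡⟨ ℤₚ.+-assoc (w y) _ _ ⟩
    w y ℤ.+ (w x ℤ.+ Σ[ w ] xs)
      ≡⟨ cong₂ ℤ._+_ (w-cong e₂) (cong₂ ℤ._+_ (w-cong e₁) (Σ-↭ w w-cong p)) ⟩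
    w y′ ℤ.+ (w x′ ℤ.+ Σ[ w ] ys)  ∎
    where open ≡.≡-Reasoning
  Σ-↭ w w-cong (Homogeneous.trans p q) = ≡.trans (Σ-↭ w w-cong p) (Σ-↭ w w-cong q)

  All-lookup : ∀ {p} {P : Pred A p} {xs} → All P xs → ∀ i → P (lookup xs i)
  All-lookup (p ∷ ps) Fin.zero    = p
  All-lookup (p ∷ ps) (Fin.suc i) = All-lookup ps i

  lookup-injective : ∀ {xs} → Unique xs → ∀ i j → lookup xs i ≈ lookup xs j → i ≡ j
  lookup-injective (_ ∷ _) Fin.zero Fin.zero _ = ≡.refl
  lookup-injective (x∉xs ∷ _) Fin.zero (Fin.suc j) e =
    contradiction (Membershipₚ.∈-resp-≈ S (sym e) (Membershipₚ.∈-lookup S _ j))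
                  (Membershipₚ.All[≉]⇒∉ S x∉xs)
  lookup-injective (x∉xs ∷ _) (Fin.suc i) Fin.zero e =
    contradiction (Membershipₚ.∈-resp-≈ S e (Membershipₚ.∈-lookup S _ i))
                  (Membershipₚ.All[≉]⇒∉ S x∉xs)
  lookup-injective (_ ∷ xs!) (Fin.suc i) (Fin.suc j) e =
    cong Fin.suc (lookup-injective xs! i j e)

  -- The index of an element is read off a membership proof, which may depend on the proof of `P x`.
  -- Since `ys` has no duplicates, the index depends on the element alone.
  enumeration-cardinality : ∀ {p} {P : Pred A p} {ys} → Unique ys → All P ys →
                            (∀ {x} → P x → x ∈ ys) → HasCardinality S P (length ys)
  enumeration-cardinality {P = P} {ys} ys! sound ∈ys = record
    { to        = λ (x , p) → Any.index (∈ys p)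
    ; from      = λ i → lookup ys i , All-lookup sound i
    ; to-cong   = λ {(x , p)} {(y , p′)} x≈y → lookup-injective ys! _ _
        (trans (sym (Anyₚ.lookup-index (∈ys p))) (trans x≈y (Anyₚ.lookup-index (∈ys p′))))
    ; from-cong = λ where ≡.refl → refl
    ; inverse   =
        (λ {i} {(y , p)} y≈i → lookup-injective ys! _ _
          (trans (sym (Anyₚ.lookup-index (∈ys p))) y≈i))
      , (λ { {(x , p)} ≡.refl → sym (Anyₚ.lookup-index (∈ys p)) })
    }

-- The commutative ring of polynomials and evaluation

module PolynomialRing {c ℓ} (R : CommutativeRing c ℓ) where

  open CommutativeRing R
  open Polynomial R
  open Setoid polySetoid public using () renaming (sym to ≈ₚ-sym; trans to ≈ₚ-trans)

  infixr 7 _·ₚ_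
  _·ₚ_ : Carrier → Poly → Poly
  a ·ₚ f = map (a *_) f

  x·_ : Poly → Poly
  x· f = 0# ∷ f

  -ₚ_ : Poly → Poly
  -ₚ_ = map (λ a → - a)

  coeff-+ : ∀ f g i → coeff (f +ₚ g) i ≈ coeff f i + coeff g i
  coeff-+ []      g       i       = sym (+-identityˡ _)
  coeff-+ (a ∷ f) []      i       = sym (+-identityʳ _)
  coeff-+ (a ∷ f) (b ∷ g) zero    = refl
  coeff-+ (a ∷ f) (b ∷ g) (suc i) = coeff-+ f g i

  coeff-· : ∀ a f i → coeff (a ·ₚ f) i ≈ a * coeff f i
  coeff-· a []      i       = sym (zeroʳ a)
  coeff-· a (b ∷ f) zero    = refl
  coeff-· a (b ∷ f) (suc i) = coeff-· a f i

  coeff-neg : ∀ f i → coeff (-ₚ f) i ≈ - coeff f i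
  coeff-neg []      i       = sym -0#≈0#
    where open import Algebra.Properties.Ring ring using (-0#≈0#)
  coeff-neg (b ∷ f) zero    = refl
  coeff-neg (b ∷ f) (suc i) = coeff-neg f i

  ∷-cong : ∀ {a b f g} → a ≈ b → f ≈ₚ g → a ∷ f ≈ₚ b ∷ g
  ∷-cong a≈b f≈g zero    = a≈b
  ∷-cong a≈b f≈g (suc i) = f≈g i

  ∷-≈[] : ∀ {a f} → a ≈ 0# → f ≈ₚ [] → a ∷ f ≈ₚ []
  ∷-≈[] a≈0 f≈0 zero    = a≈0
  ∷-≈[] a≈0 f≈0 (suc i) = f≈0 i

  +ₚ-cong : ∀ {f f′ g g′} → f ≈ₚ f′ → g ≈ₚ g′ → f +ₚ g ≈ₚ f′ +ₚ g′
  +ₚ-cong {f} {f′} {g} {g′} f≈f′ g≈g′ i = begin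
    coeff (f +ₚ g) i          ≈⟨ coeff-+ f g i ⟩
    coeff f i + coeff g i     ≈⟨ +-cong (f≈f′ i) (g≈g′ i) ⟩
    coeff f′ i + coeff g′ i   ≈⟨ coeff-+ f′ g′ i ⟨
    coeff (f′ +ₚ g′) i        ∎
    where open ≈-Reasoning setoid

  +ₚ-comm : ∀ f g → f +ₚ g ≈ₚ g +ₚ f
  +ₚ-comm f g i = trans (coeff-+ f g i) (trans (+-comm _ _) (sym (coeff-+ g f i)))

  +ₚ-assoc : ∀ f g h → (f +ₚ g) +ₚ h ≈ₚ f +ₚ (g +ₚ h)
  +ₚ-assoc f g h i = begin
    coeff ((f +ₚ g) +ₚ h) i                 ≈⟨ coeff-+ (f +ₚ g) h i ⟩
    coeff (f +ₚ g) i + coeff h i            ≈⟨ +-congʳ (coeff-+ f g i) ⟩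
    coeff f i + coeff g i + coeff h i       ≈⟨ +-assoc _ _ _ ⟩
    coeff f i + (coeff g i + coeff h i)     ≈⟨ +-congˡ (coeff-+ g h i) ⟨
    coeff f i + coeff (g +ₚ h) i            ≈⟨ coeff-+ f (g +ₚ h) i ⟨
    coeff (f +ₚ (g +ₚ h)) i                 ∎
    where open ≈-Reasoning setoid

  +ₚ-identityʳ : ∀ f → f +ₚ [] ≈ₚ f
  +ₚ-identityʳ f i = trans (coeff-+ f [] i) (+-identityʳ _)

  -ₚ-inverseʳ : ∀ f → f +ₚ (-ₚ f) ≈ₚ []
  -ₚ-inverseʳ f i = trans (coeff-+ f (-ₚ f) i) (trans (+-congˡ (coeff-neg f i)) (-‿inverseʳ _))

  -ₚ-cong : ∀ {f g} → f ≈ₚ g → -ₚ f ≈ₚ -ₚ g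
  -ₚ-cong {f} {g} f≈g i = trans (coeff-neg f i) (trans (-‿cong (f≈g i)) (sym (coeff-neg g i)))

  ·-cong : ∀ {a b f g} → a ≈ b → f ≈ₚ g → a ·ₚ f ≈ₚ b ·ₚ g
  ·-cong {a} {b} {f} {g} a≈b f≈g i =
    trans (coeff-· a f i) (trans (*-cong a≈b (f≈g i)) (sym (coeff-· b g i)))

  ·-zeroˡ : ∀ {a} f → a ≈ 0# → a ·ₚ f ≈ₚ []
  ·-zeroˡ {a} f a≈0 i = trans (coeff-· a f i) (trans (*-congʳ a≈0) (zeroˡ _))

  ·-identityˡ : ∀ f → 1# ·ₚ f ≈ₚ f
  ·-identityˡ f i = trans (coeff-· 1# f i) (*-identityˡ _)

  ·-assoc : ∀ a b f → a ·ₚ b ·ₚ f ≈ₚ (a * b) ·ₚ f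
  ·-assoc a b f i = begin
    coeff (a ·ₚ b ·ₚ f) i   ≈⟨ coeff-· a (b ·ₚ f) i ⟩
    a * coeff (b ·ₚ f) i    ≈⟨ *-congˡ (coeff-· b f i) ⟩
    a * (b * coeff f i)     ≈⟨ *-assoc _ _ _ ⟨
    a * b * coeff f i       ≈⟨ coeff-· (a * b) f i ⟨
    coeff ((a * b) ·ₚ f) i  ∎
    where open ≈-Reasoning setoid

  ·-distribˡ : ∀ a f g → a ·ₚ (f +ₚ g) ≈ₚ a ·ₚ f +ₚ a ·ₚ g
  ·-distribˡ a f g i = begin
    coeff (a ·ₚ (f +ₚ g)) i                  ≈⟨ coeff-· a (f +ₚ g) i ⟩
    a * coeff (f +ₚ g) i                     ≈⟨ *-congˡ (coeff-+ f g i) ⟩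
    a * (coeff f i + coeff g i)              ≈⟨ distribˡ a _ _ ⟩
    a * coeff f i + a * coeff g i            ≈⟨ +-cong (coeff-· a f i) (coeff-· a g i) ⟨
    coeff (a ·ₚ f) i + coeff (a ·ₚ g) i      ≈⟨ coeff-+ (a ·ₚ f) (a ·ₚ g) i ⟨
    coeff (a ·ₚ f +ₚ a ·ₚ g) i               ∎
    where open ≈-Reasoning setoid

  private
    interchange : ∀ f g h k → (f +ₚ g) +ₚ (h +ₚ k) ≈ₚ (f +ₚ h) +ₚ (g +ₚ k)
    interchange f g h k i = begin
      coeff ((f +ₚ g) +ₚ (h +ₚ k)) i                            ≈⟨ expand f g h k ⟩
      (coeff f i + coeff g i) + (coeff h i + coeff k i)         ≈⟨ +-interchange _ _ _ _ ⟩
      (coeff f i + coeff h i) + (coeff g i + coeff k i)         ≈⟨ expand f h g k ⟨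
      coeff ((f +ₚ h) +ₚ (g +ₚ k)) i                            ∎
      where
      open ≈-Reasoning setoid
      open import Algebra.Properties.CommutativeSemigroup +-commutativeSemigroup
        using () renaming (interchange to +-interchange)
      expand : ∀ f g h k → coeff ((f +ₚ g) +ₚ (h +ₚ k)) i ≈ (coeff f i + coeff g i) + (coeff h i + coeff k i)
      expand f g h k = trans (coeff-+ (f +ₚ g) (h +ₚ k) i) (+-cong (coeff-+ f g i) (coeff-+ h k i))

  *ₚ-zeroʳ : ∀ f → f *ₚ [] ≈ₚ []
  *ₚ-zeroʳ []      = (λ _ → refl)
  *ₚ-zeroʳ (a ∷ f) = ∷-≈[] refl (*ₚ-zeroʳ f)

  -- A list of zeros equals `[]`, so congruence in the left factor has to compare lists of different
  -- lengths; this covers those cases.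
  *ₚ-zeroˡ : ∀ {f} g → f ≈ₚ [] → f *ₚ g ≈ₚ []
  *ₚ-zeroˡ {[]}    g f≈0 = (λ _ → refl)
  *ₚ-zeroˡ {a ∷ f} g f≈0 = +ₚ-cong {a ·ₚ g} {[]} {x· (f *ₚ g)} {[]}
    (·-zeroˡ g (f≈0 0)) (∷-≈[] refl (*ₚ-zeroˡ {f} g (λ i → f≈0 (suc i))))

  *ₚ-congˡ : ∀ f {g g′} → g ≈ₚ g′ → f *ₚ g ≈ₚ f *ₚ g′
  *ₚ-congˡ []      g≈g′ = (λ _ → refl)
  *ₚ-congˡ (a ∷ f) {g} {g′} g≈g′ = +ₚ-cong {a ·ₚ g} {a ·ₚ g′} {x· (f *ₚ g)} {x· (f *ₚ g′)}
    (·-cong {f = g} {g′} refl g≈g′) (∷-cong refl (*ₚ-congˡ f g≈g′))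

  *ₚ-congʳ : ∀ {f f′} g → f ≈ₚ f′ → f *ₚ g ≈ₚ f′ *ₚ g
  *ₚ-congʳ {[]}    {f′}     g f≈f′ = ≈ₚ-sym {f′ *ₚ g} {[]} (*ₚ-zeroˡ {f′} g (≈ₚ-sym {[]} {f′} f≈f′))
  *ₚ-congʳ {a ∷ f} {[]}     g f≈f′ = *ₚ-zeroˡ {a ∷ f} g f≈f′
  *ₚ-congʳ {a ∷ f} {b ∷ f′} g f≈f′ = +ₚ-cong {a ·ₚ g} {b ·ₚ g} {x· (f *ₚ g)} {x· (f′ *ₚ g)}
    (·-cong {f = g} {g} (f≈f′ 0) (λ _ → refl)) (∷-cong refl (*ₚ-congʳ {f} {f′} g (λ i → f≈f′ (suc i))))

  *ₚ-distribˡ : ∀ f g h → f *ₚ (g +ₚ h) ≈ₚ f *ₚ g +ₚ f *ₚ h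
  *ₚ-distribˡ []      g h = (λ _ → refl)
  *ₚ-distribˡ (a ∷ f) g h = begin
    a ·ₚ (g +ₚ h) +ₚ x· (f *ₚ (g +ₚ h))
      ≈⟨ +ₚ-cong {a ·ₚ (g +ₚ h)} {a ·ₚ g +ₚ a ·ₚ h} {x· (f *ₚ (g +ₚ h))} {x· (f *ₚ g) +ₚ x· (f *ₚ h)} (·-distribˡ a g h) (∷-cong (sym (+-identityʳ 0#)) (*ₚ-distribˡ f g h)) ⟩
    (a ·ₚ g +ₚ a ·ₚ h) +ₚ (x· (f *ₚ g) +ₚ x· (f *ₚ h))
      ≈⟨ interchange (a ·ₚ g) (a ·ₚ h) (x· (f *ₚ g)) (x· (f *ₚ h)) ⟩
    (a ·ₚ g +ₚ x· (f *ₚ g)) +ₚ (a ·ₚ h +ₚ x· (f *ₚ h))       ∎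
    where open ≈-Reasoning polySetoid

  -- The defining equation of `_*ₚ_` mirrored to the right factor; commutativity follows from the
  -- two by induction.
  *ₚ-∷ʳ : ∀ g a f → g *ₚ (a ∷ f) ≈ₚ a ·ₚ g +ₚ x· (g *ₚ f)
  *ₚ-∷ʳ []      a f = ≈ₚ-sym {x· []} {[]} (∷-≈[] refl (λ _ → refl))
  *ₚ-∷ʳ (b ∷ g) a f zero    = +-congʳ (*-comm b a)
  *ₚ-∷ʳ (b ∷ g) a f (suc i) = go i
    where
    open ≈-Reasoning polySetoid
    go : b ·ₚ f +ₚ g *ₚ (a ∷ f) ≈ₚ a ·ₚ g +ₚ (b ·ₚ f +ₚ x· (g *ₚ f))
    go = begin
      b ·ₚ f +ₚ g *ₚ (a ∷ f)
        ≈⟨ +ₚ-cong {b ·ₚ f} {b ·ₚ f} {g *ₚ (a ∷ f)} {a ·ₚ g +ₚ x· (g *ₚ f)} (λ _ → refl) (*ₚ-∷ʳ g a f) ⟩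
      b ·ₚ f +ₚ (a ·ₚ g +ₚ x· (g *ₚ f))       ≈⟨ +ₚ-assoc (b ·ₚ f) (a ·ₚ g) (x· (g *ₚ f)) ⟨
      (b ·ₚ f +ₚ a ·ₚ g) +ₚ x· (g *ₚ f)
        ≈⟨ +ₚ-cong {b ·ₚ f +ₚ a ·ₚ g} {a ·ₚ g +ₚ b ·ₚ f} {x· (g *ₚ f)} {x· (g *ₚ f)} (+ₚ-comm (b ·ₚ f) (a ·ₚ g)) (λ _ → refl) ⟩
      (a ·ₚ g +ₚ b ·ₚ f) +ₚ x· (g *ₚ f)       ≈⟨ +ₚ-assoc (a ·ₚ g) (b ·ₚ f) (x· (g *ₚ f)) ⟩
      a ·ₚ g +ₚ (b ·ₚ f +ₚ x· (g *ₚ f))       ∎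

  *ₚ-comm : ∀ f g → f *ₚ g ≈ₚ g *ₚ f
  *ₚ-comm []      g = ≈ₚ-sym {g *ₚ []} {[]} (*ₚ-zeroʳ g)
  *ₚ-comm (a ∷ f) g = begin
    a ·ₚ g +ₚ x· (f *ₚ g)
      ≈⟨ +ₚ-cong {a ·ₚ g} {a ·ₚ g} {x· (f *ₚ g)} {x· (g *ₚ f)} (λ _ → refl) (∷-cong refl (*ₚ-comm f g)) ⟩
    a ·ₚ g +ₚ x· (g *ₚ f)   ≈⟨ *ₚ-∷ʳ g a f ⟨
    g *ₚ (a ∷ f)            ∎
    where open ≈-Reasoning polySetoid

  *ₚ-distribʳ : ∀ f g h → (g +ₚ h) *ₚ f ≈ₚ g *ₚ f +ₚ h *ₚ f
  *ₚ-distribʳ f g h = begin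
    (g +ₚ h) *ₚ f       ≈⟨ *ₚ-comm (g +ₚ h) f ⟩
    f *ₚ (g +ₚ h)       ≈⟨ *ₚ-distribˡ f g h ⟩
    f *ₚ g +ₚ f *ₚ h    ≈⟨ +ₚ-cong {f *ₚ g} {g *ₚ f} {f *ₚ h} {h *ₚ f} (*ₚ-comm f g) (*ₚ-comm f h) ⟩
    g *ₚ f +ₚ h *ₚ f    ∎
    where open ≈-Reasoning polySetoid

  ·-*ₚ-assoc : ∀ a f g → (a ·ₚ f) *ₚ g ≈ₚ a ·ₚ (f *ₚ g)
  ·-*ₚ-assoc a []      g = (λ _ → refl)
  ·-*ₚ-assoc a (b ∷ f) g = begin
    (a * b) ·ₚ g +ₚ x· ((a ·ₚ f) *ₚ g)
      ≈⟨ +ₚ-cong {(a * b) ·ₚ g} {a ·ₚ b ·ₚ g} {x· ((a ·ₚ f) *ₚ g)} {a ·ₚ x· (f *ₚ g)} (≈ₚ-sym {a ·ₚ b ·ₚ g} {(a * b) ·ₚ g} (·-assoc a b g)) (∷-cong (sym (zeroʳ a)) (·-*ₚ-assoc a f g)) ⟩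
    a ·ₚ b ·ₚ g +ₚ a ·ₚ x· (f *ₚ g)          ≈⟨ ·-distribˡ a (b ·ₚ g) (x· (f *ₚ g)) ⟨
    a ·ₚ (b ·ₚ g +ₚ x· (f *ₚ g))             ∎
    where open ≈-Reasoning polySetoid

  x·-*ₚ-assoc : ∀ f g → (x· f) *ₚ g ≈ₚ x· (f *ₚ g)
  x·-*ₚ-assoc f g = +ₚ-cong {0# ·ₚ g} {[]} {x· (f *ₚ g)} {x· (f *ₚ g)} (·-zeroˡ g refl) (λ _ → refl)

  *ₚ-assoc : ∀ f g h → (f *ₚ g) *ₚ h ≈ₚ f *ₚ (g *ₚ h)
  *ₚ-assoc []      g h = (λ _ → refl)
  *ₚ-assoc (a ∷ f) g h = begin
    (a ·ₚ g +ₚ x· (f *ₚ g)) *ₚ h             ≈⟨ *ₚ-distribʳ h (a ·ₚ g) (x· (f *ₚ g)) ⟩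
    (a ·ₚ g) *ₚ h +ₚ (x· (f *ₚ g)) *ₚ h
      ≈⟨ +ₚ-cong {(a ·ₚ g) *ₚ h} {a ·ₚ (g *ₚ h)} {(x· (f *ₚ g)) *ₚ h} {x· ((f *ₚ g) *ₚ h)} (·-*ₚ-assoc a g h) (x·-*ₚ-assoc (f *ₚ g) h) ⟩
    a ·ₚ (g *ₚ h) +ₚ x· ((f *ₚ g) *ₚ h)
      ≈⟨ +ₚ-cong {a ·ₚ (g *ₚ h)} {a ·ₚ (g *ₚ h)} {x· ((f *ₚ g) *ₚ h)} {x· (f *ₚ (g *ₚ h))} (λ _ → refl) (∷-cong refl (*ₚ-assoc f g h)) ⟩
    a ·ₚ (g *ₚ h) +ₚ x· (f *ₚ (g *ₚ h))      ∎
    where open ≈-Reasoning polySetoid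

  *ₚ-identityˡ : ∀ f → (1# ∷ []) *ₚ f ≈ₚ f
  *ₚ-identityˡ f = begin
    1# ·ₚ f +ₚ x· []
      ≈⟨ +ₚ-cong {1# ·ₚ f} {f} {x· []} {[]} (·-identityˡ f) (∷-≈[] refl (λ _ → refl)) ⟩
    f +ₚ []           ≈⟨ +ₚ-identityʳ f ⟩
    f                 ∎
    where open ≈-Reasoning polySetoid

  polyCommutativeRing : CommutativeRing c ℓ
  polyCommutativeRing = record
    { Carrier = Poly
    ; _≈_     = _≈ₚ_
    ; _+_     = _+ₚ_
    ; _*_     = _*ₚ_
    ; -_      = -ₚ_
    ; 0#      = []
    ; 1#      = 1# ∷ []
    ; isCommutativeRing = record
      { isRing = record
        { +-isAbelianGroup = record
          { isGroup = record
            { isMonoid = record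
              { isSemigroup = record
                { isMagma = record
                  { isEquivalence = Setoid.isEquivalence polySetoid
                  ; ∙-cong        = λ {f} {f′} {g} {g′} → +ₚ-cong {f} {f′} {g} {g′}
                  }
                ; assoc = +ₚ-assoc
                }
              ; identity = (λ _ _ → refl) , +ₚ-identityʳ
              }
            ; inverse = (λ f → ≈ₚ-trans {(-ₚ f) +ₚ f} {f +ₚ (-ₚ f)} {[]} (+ₚ-comm (-ₚ f) f) (-ₚ-inverseʳ f)) , -ₚ-inverseʳ
            ; ⁻¹-cong = λ {f} {g} → -ₚ-cong {f} {g}
            }
          ; comm = +ₚ-comm
          }
        ; *-cong = λ {f} {f′} {g} {g′} f≈f′ g≈g′ → ≈ₚ-trans {f *ₚ g} {f′ *ₚ g} {f′ *ₚ g′} (*ₚ-congʳ {f} {f′} g f≈f′) (*ₚ-congˡ f′ {g} {g′} g≈g′)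
        ; *-assoc = *ₚ-assoc
        ; *-identity = *ₚ-identityˡ , λ f → ≈ₚ-trans {f *ₚ (1# ∷ [])} {(1# ∷ []) *ₚ f} {f} (*ₚ-comm f (1# ∷ [])) (*ₚ-identityˡ f)
        ; distrib = *ₚ-distribˡ , *ₚ-distribʳ
        }
      ; *-comm = *ₚ-comm
      }
    }

  eval-≈[] : ∀ {f} x → f ≈ₚ [] → eval f x ≈ 0#
  eval-≈[] {[]}    x f≈0 = refl
  eval-≈[] {a ∷ f} x f≈0 = begin
    a + x * eval f x  ≈⟨ +-cong (f≈0 0) (*-congˡ (eval-≈[] {f} x (λ i → f≈0 (suc i)))) ⟩
    0# + x * 0#       ≈⟨ trans (+-identityˡ _) (zeroʳ x) ⟩
    0#                ∎
    where open ≈-Reasoning setoid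

  eval-cong : ∀ {f g} x → f ≈ₚ g → eval f x ≈ eval g x
  eval-cong {[]}    {g}     x f≈g = sym (eval-≈[] {g} x (≈ₚ-sym {[]} {g} f≈g))
  eval-cong {a ∷ f} {[]}    x f≈g = eval-≈[] {a ∷ f} x f≈g
  eval-cong {a ∷ f} {b ∷ g} x f≈g =
    +-cong (f≈g 0) (*-congˡ (eval-cong {f} {g} x (λ i → f≈g (suc i))))

  open RingSolver commutativeSemiring

  eval-+ : ∀ f g x → eval (f +ₚ g) x ≈ eval f x + eval g x
  eval-+ []      g       x = sym (+-identityˡ _)
  eval-+ (a ∷ f) []      x = sym (+-identityʳ _)
  eval-+ (a ∷ f) (b ∷ g) x = trans (+-congˡ (*-congˡ (eval-+ f g x)))
    (solve 5 (λ a b x F G → a :+ b :+ x :* (F :+ G) := a :+ x :* F :+ (b :+ x :* G)) refl a b x (eval f x) (eval g x))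

  eval-· : ∀ a f x → eval (a ·ₚ f) x ≈ a * eval f x
  eval-· a []      x = sym (zeroʳ a)
  eval-· a (b ∷ f) x = trans (+-congˡ (*-congˡ (eval-· a f x)))
    (solve 4 (λ a b x F → a :* b :+ x :* (a :* F) := a :* (b :+ x :* F)) refl a b x (eval f x))

  eval-* : ∀ f g x → eval (f *ₚ g) x ≈ eval f x * eval g x
  eval-* []      g x = sym (zeroˡ _)
  eval-* (a ∷ f) g x = begin
    eval (a ·ₚ g +ₚ x· (f *ₚ g)) x                   ≈⟨ eval-+ (a ·ₚ g) (x· (f *ₚ g)) x ⟩
    eval (a ·ₚ g) x + (0# + x * eval (f *ₚ g) x)
      ≈⟨ +-cong (eval-· a g x) (+-congˡ (*-congˡ (eval-* f g x))) ⟩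
    a * eval g x + (0# + x * (eval f x * eval g x))
      ≈⟨ solve 4 (λ a x F G → a :* G :+ (con 0 :+ x :* (F :* G)) := (a :+ x :* F) :* G) refl a x (eval f x) (eval g x) ⟩
    (a + x * eval f x) * eval g x                    ∎
    where open ≈-Reasoning setoid

-- Degrees, monic polynomials and division with remainder

module Degree {c ℓ} (R : CommutativeRing c ℓ) where

  open CommutativeRing R
  open Polynomial R
  open PolynomialRing R

  -- A strict bound gives the zero polynomial a place, at `DegreeBelow 0`, so that remainders need
  -- no degree of their own.
  DegreeBelow : ℕ → Poly → Set ℓ
  DegreeBelow n f = ∀ i → n ℕ.≤ i → coeff f i ≈ 0#

  degreeBelow-mono : ∀ {m n} f → m ℕ.≤ n → DegreeBelow m f → DegreeBelow n f
  degreeBelow-mono f m≤n f<m i n≤i = f<m i (ℕₚ.≤-trans m≤n n≤i)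

  degreeBelow-resp : ∀ {n f g} → f ≈ₚ g → DegreeBelow n f → DegreeBelow n g
  degreeBelow-resp f≈g f<n i n≤i = trans (sym (f≈g i)) (f<n i n≤i)

  coeff-*-suc : ∀ a f g i → coeff ((a ∷ f) *ₚ g) (suc i) ≈ a * coeff g (suc i) + coeff (f *ₚ g) i
  coeff-*-suc a f g i = trans (coeff-+ (a ·ₚ g) (x· (f *ₚ g)) (suc i)) (+-congʳ (coeff-· a g (suc i)))

  private
    vanish : ∀ {x y z} → x ≈ 0# → y ≈ 0# → z * x + y ≈ 0#
    vanish {z = z} x≈0 y≈0 = trans (+-cong (trans (*-congˡ x≈0) (zeroʳ z)) y≈0) (+-identityˡ 0#)

    coeff-constant-* : ∀ a f g → f ≈ₚ [] → ∀ i → coeff ((a ∷ f) *ₚ g) i ≈ a * coeff g i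
    coeff-constant-* a f g f≈0 i = begin
      coeff (a ·ₚ g +ₚ x· (f *ₚ g)) i              ≈⟨ coeff-+ (a ·ₚ g) (x· (f *ₚ g)) i ⟩
      coeff (a ·ₚ g) i + coeff (x· (f *ₚ g)) i
        ≈⟨ +-cong (coeff-· a g i) (∷-≈[] refl (*ₚ-zeroˡ {f} g f≈0) i) ⟩
      a * coeff g i + 0#                           ≈⟨ +-identityʳ _ ⟩
      a * coeff g i                                ∎
      where open ≈-Reasoning setoid

  -- Strict bounds a and b on the factors give a + b - 1 on the product; writing a as `suc m` avoids
  -- the subtraction.
  degreeBelow-* : ∀ {m n} f g → DegreeBelow (suc m) f → DegreeBelow n g → DegreeBelow (m ℕ.+ n) (f *ₚ g)
  degreeBelow-* []      g f<m g<n i m+n≤i = refl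
  degreeBelow-* {zero}  (a ∷ f) g f<m g<n i m+n≤i =
    trans (coeff-constant-* a f g (λ j → f<m (suc j) (s≤s z≤n)) i)
      (trans (*-congˡ (g<n i m+n≤i)) (zeroʳ a))
  degreeBelow-* {suc m} {n} (a ∷ f) g f<m g<n (suc i) (s≤s m+n≤i) =
    trans (coeff-*-suc a f g i)
      (vanish (g<n (suc i) (ℕₚ.m≤n⇒m≤1+n (ℕₚ.≤-trans (ℕₚ.m≤n+m n m) m+n≤i)))
              (degreeBelow-* {m} f g (λ j m<j → f<m (suc j) (s≤s m<j)) g<n i m+n≤i))

  coeff-top-* : ∀ {m n} f g → DegreeBelow (suc m) f → DegreeBelow (suc n) g →
                coeff (f *ₚ g) (m ℕ.+ n) ≈ coeff f m * coeff g n
  coeff-top-* {m} {n} [] g f<m g<n = sym (zeroˡ _)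
  coeff-top-* {zero} {n} (a ∷ f) g f<m g<n = coeff-constant-* a f g (λ j → f<m (suc j) (s≤s z≤n)) n
  coeff-top-* {suc m} {n} (a ∷ f) g f<m g<n = begin
    coeff ((a ∷ f) *ₚ g) (suc (m ℕ.+ n))                      ≈⟨ coeff-*-suc a f g (m ℕ.+ n) ⟩
    a * coeff g (suc (m ℕ.+ n)) + coeff (f *ₚ g) (m ℕ.+ n)
      ≈⟨ +-congʳ (trans (*-congˡ (g<n _ (s≤s (ℕₚ.m≤n+m n m)))) (zeroʳ a)) ⟩
    0# + coeff (f *ₚ g) (m ℕ.+ n)                             ≈⟨ +-identityˡ _ ⟩
    coeff (f *ₚ g) (m ℕ.+ n)
      ≈⟨ coeff-top-* {m} f g (λ j m<j → f<m (suc j) (s≤s m<j)) g<n ⟩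
    coeff f m * coeff g n                                     ∎
    where open ≈-Reasoning setoid

  monic-resp : ∀ {n f g} → f ≈ₚ g → MonicOfDegree n f → MonicOfDegree n g
  monic-resp {n} {f} {g} f≈g (top , f<n) =
    trans (sym (f≈g n)) top , degreeBelow-resp {f = f} {g} f≈g f<n

  monic-* : ∀ {m n} f g → MonicOfDegree m f → MonicOfDegree n g → MonicOfDegree (m ℕ.+ n) (f *ₚ g)
  monic-* {m} {n} f g (f-top , f<m) (g-top , g<n) =
    trans (coeff-top-* {m} {n} f g f<m g<n) (trans (*-cong f-top g-top) (*-identityˡ 1#)) ,
    ≡.subst (λ k → DegreeBelow k (f *ₚ g)) (ℕₚ.+-suc m n) (degreeBelow-* {m} f g f<m g<n)

  monic-0 : ∀ {f} → MonicOfDegree 0 f → f ≈ₚ 1# ∷ []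
  monic-0 (top , f<0) zero    = top
  monic-0 (top , f<0) (suc i) = f<0 (suc i) (s≤s z≤n)

  one-monic : MonicOfDegree 0 (1# ∷ [])
  one-monic = refl , λ { (suc i) _ → refl }

  infix 4 _∣ₚ_
  _∣ₚ_ : Poly → Poly → Set _
  f ∣ₚ g = ∃ λ h → f *ₚ h ≈ₚ g

  private
    module P = CommutativeRing polyCommutativeRing
    module Pₚ = RingProperties P.ring

  ∣ₚ-respʳ : ∀ {f g h} → g ≈ₚ h → f ∣ₚ g → f ∣ₚ h
  ∣ₚ-respʳ {f} {g} {h} g≈h (k , fk≈g) = k , λ i → trans (fk≈g i) (g≈h i)

  ∣ₚ-*ʳ : ∀ {f g} h → f ∣ₚ g → f ∣ₚ g *ₚ h
  ∣ₚ-*ʳ {f} {g} h (k , fk≈g) = k *ₚ h , λ i →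
    trans (sym (*ₚ-assoc f k h i)) (*ₚ-congʳ {f *ₚ k} {g} h fk≈g i)

  +ₚ-≈[] : ∀ {f g r} → f ≈ₚ g +ₚ r → r ≈ₚ [] → g ≈ₚ f
  +ₚ-≈[] {f} {g} {r} f≈g+r r≈0 i = sym (begin
    coeff f i              ≈⟨ f≈g+r i ⟩
    coeff (g +ₚ r) i       ≈⟨ coeff-+ g r i ⟩
    coeff g i + coeff r i  ≈⟨ +-congˡ (r≈0 i) ⟩
    coeff g i + 0#         ≈⟨ +-identityʳ _ ⟩
    coeff g i              ∎)
    where open ≈-Reasoning setoid

  *ₚ-difference : ∀ P f g → P *ₚ (f +ₚ (-ₚ g)) ≈ₚ P *ₚ f +ₚ (-ₚ (P *ₚ g))
  *ₚ-difference P f g i = trans (*ₚ-distribˡ P f (-ₚ g) i)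
    (+ₚ-cong {P *ₚ f} {P *ₚ f} {P *ₚ (-ₚ g)} { -ₚ (P *ₚ g)} (λ _ → refl)
      (λ j → sym (Pₚ.-‿distribʳ-* P g j)) i)

  ∣ₚ-difference : ∀ {P f g h} → f ≈ₚ g +ₚ h → P ∣ₚ f → P ∣ₚ g → P ∣ₚ h
  ∣ₚ-difference {P} {f} {g} {h} f≈g+h (k , Pk≈f) (l , Pl≈g) = k +ₚ (-ₚ l) , (begin
    P *ₚ (k +ₚ (-ₚ l))           ≈⟨ *ₚ-difference P k l ⟩
    P *ₚ k +ₚ (-ₚ (P *ₚ l))
      ≈⟨ +ₚ-cong {P *ₚ k} {g +ₚ h} { -ₚ (P *ₚ l)} { -ₚ g} (λ i → trans (Pk≈f i) (f≈g+h i)) (-ₚ-cong {P *ₚ l} {g} Pl≈g) ⟩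
    (g +ₚ h) +ₚ (-ₚ g)           ≈⟨ Pₚ.xyx⁻¹≈y g h ⟩
    h                            ∎)
    where open ≈-Reasoning polySetoid

  -- Long division along the Horner form of the dividend. From f = P k + r it follows that a + x f =
  -- P (x k) + (a + x r), and `s` = a + x r has degree at most `d`. Subtracting one multiple of the
  -- monic `P`, by the coefficient of `s` at `d`, brings the remainder below `d`.
  divMod : ∀ {d} P → MonicOfDegree d P → ∀ f →
           ∃₂ λ k r → f ≈ₚ P *ₚ k +ₚ r × DegreeBelow d r
  divMod P P-monic [] = [] , [] , (λ i → sym (trans (+ₚ-identityʳ (P *ₚ []) i) (*ₚ-zeroʳ P i))) , λ _ _ → refl
  divMod {d} P P-monic@(P-top , P<d) (a ∷ f) with divMod P P-monic f
  ... | k , r , f≈Pk+r , r<d = b ∷ k , r′ , P.sym {P *ₚ (b ∷ k) +ₚ r′} {a ∷ f} eq , r′<d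
    where
    s  = a ∷ r
    b  = coeff s d
    r′ = s +ₚ (-ₚ (b ·ₚ P))

    s<1+d : DegreeBelow (suc d) s
    s<1+d (suc i) (s≤s d≤i) = r<d i d≤i

    coeff-r′ : ∀ i → coeff r′ i ≈ coeff s i - b * coeff P i
    coeff-r′ i = trans (coeff-+ s (-ₚ (b ·ₚ P)) i)
      (+-congˡ (trans (coeff-neg (b ·ₚ P) i) (-‿cong (coeff-· b P i))))

    r′<d : DegreeBelow d r′
    r′<d i d≤i with ℕₚ.m≤n⇒m<n∨m≡n d≤i
    ... | inj₁ d<i = trans (coeff-r′ i) (trans (+-cong (s<1+d i d<i)
            (trans (-‿cong (trans (*-congˡ (P<d i d<i)) (zeroʳ b))) (RingProperties.-0#≈0# ring))) (+-identityˡ 0#))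
    ... | inj₂ ≡.refl = trans (coeff-r′ d) (trans (+-congˡ (-‿cong (trans (*-congˡ P-top) (*-identityʳ b)))) (-‿inverseʳ b))

    open ≈-Reasoning polySetoid
    eq : P *ₚ (b ∷ k) +ₚ r′ ≈ₚ a ∷ f
    eq = begin
      P *ₚ (b ∷ k) +ₚ r′
        ≈⟨ +ₚ-cong {P *ₚ (b ∷ k)} {b ·ₚ P +ₚ x· (P *ₚ k)} {r′} {r′} (*ₚ-∷ʳ P b k) (λ _ → refl) ⟩
      (b ·ₚ P +ₚ x· (P *ₚ k)) +ₚ (s +ₚ (-ₚ (b ·ₚ P)))
        ≈⟨ +ₚ-assoc (b ·ₚ P +ₚ x· (P *ₚ k)) s (-ₚ (b ·ₚ P)) ⟨
      ((b ·ₚ P +ₚ x· (P *ₚ k)) +ₚ s) +ₚ (-ₚ (b ·ₚ P))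
        ≈⟨ +ₚ-cong {(b ·ₚ P +ₚ x· (P *ₚ k)) +ₚ s} {b ·ₚ P +ₚ (x· (P *ₚ k) +ₚ s)} { -ₚ (b ·ₚ P)} (+ₚ-assoc (b ·ₚ P) (x· (P *ₚ k)) s) (λ _ → refl) ⟩
      (b ·ₚ P +ₚ (x· (P *ₚ k) +ₚ s)) +ₚ (-ₚ (b ·ₚ P))
        ≈⟨ Pₚ.xyx⁻¹≈y (b ·ₚ P) (x· (P *ₚ k) +ₚ s) ⟩
      x· (P *ₚ k) +ₚ s
        ≈⟨ ∷-cong (+-identityˡ a) (P.sym {f} {P *ₚ k +ₚ r} f≈Pk+r) ⟩
      a ∷ f                                               ∎

-- Polynomials over a finite field and Euclid's lemma

module FiniteFieldPolynomials {q c ℓ} (𝔽 : FiniteField q c ℓ) where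

  open FiniteField 𝔽
  open Polynomial commutativeRing
  open PolynomialRing commutativeRing
  open Degree commutativeRing

  private
    module F = Inverse size
    module P = CommutativeRing polyCommutativeRing
    module Pₚ = RingProperties P.ring

  infix 4 _≈?_
  _≈?_ : Decidable _≈_
  x ≈? y = map′
    (λ e → trans (sym (F.strictlyInverseʳ x)) (trans (F.from-cong e) (F.strictlyInverseʳ y)))
    F.to-cong (F.to x ≟ᶠ F.to y)

  cancel : ∀ {a b} → ¬ a ≈ 0# → a * b ≈ 0# → b ≈ 0#
  cancel {a} {b} a≉0 ab≈0 with a⁻¹ , aa⁻¹≈1 ← inverse a a≉0 = begin
    b                ≈⟨ *-identityˡ b ⟨
    1# * b           ≈⟨ *-congʳ (trans (*-comm a⁻¹ a) aa⁻¹≈1) ⟨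
    a⁻¹ * a * b      ≈⟨ *-assoc a⁻¹ a b ⟩
    a⁻¹ * (a * b)    ≈⟨ *-congˡ ab≈0 ⟩
    a⁻¹ * 0#         ≈⟨ zeroʳ a⁻¹ ⟩
    0#               ∎
    where open ≈-Reasoning setoid

  *-≉0 : ∀ {a b} → ¬ a ≈ 0# → ¬ b ≈ 0# → ¬ a * b ≈ 0#
  *-≉0 a≉0 b≉0 ab≈0 = b≉0 (cancel a≉0 ab≈0)

  HasDegree : ℕ → Poly → Set ℓ
  HasDegree n f = ¬ coeff f n ≈ 0# × DegreeBelow (suc n) f

  degree-view : ∀ f → f ≈ₚ [] ⊎ ∃ λ n → HasDegree n f
  degree-view [] = inj₁ λ _ → refl
  degree-view (a ∷ f) with degree-view f | a ≈? 0#
  ... | inj₂ (n , top≉0 , f<n) | _ = inj₂ (suc n , top≉0 , λ { (suc i) (s≤s n<i) → f<n i n<i })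
  ... | inj₁ f≈0 | yes a≈0 = inj₁ (∷-≈[] a≈0 f≈0)
  ... | inj₁ f≈0 | no a≉0  = inj₂ (0 , a≉0 , λ { (suc i) _ → f≈0 i })

  degree-unique : ∀ {m n f} → HasDegree m f → HasDegree n f → m ≡ n
  degree-unique {m} {n} (f-m , f<m) (f-n , f<n) with ℕₚ.<-cmp m n
  ... | tri< m<n _ _ = contradiction (f<m n m<n) f-n
  ... | tri≈ _ m≡n _ = m≡n
  ... | tri> _ _ n<m = contradiction (f<n m n<m) f-m

  degree-< : ∀ {m n f} → HasDegree m f → DegreeBelow n f → m ℕ.< n
  degree-< {m} (f-m , _) f<n = ℕₚ.≰⇒> (λ n≤m → f-m (f<n m n≤m))

  degree-* : ∀ {m n} f g → HasDegree m f → HasDegree n g → HasDegree (m ℕ.+ n) (f *ₚ g)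
  degree-* {m} {n} f g (f-m , f<m) (g-n , g<n) =
    (λ e → *-≉0 f-m g-n (trans (sym (coeff-top-* {m} {n} f g f<m g<n)) e)) ,
    ≡.subst (λ k → DegreeBelow k (f *ₚ g)) (ℕₚ.+-suc m n) (degreeBelow-* {m} f g f<m g<n)

  degree-resp : ∀ {n f g} → f ≈ₚ g → HasDegree n f → HasDegree n g
  degree-resp {n} {f} {g} f≈g (f-n , f<n) =
    (λ e → f-n (trans (f≈g n) e)) , degreeBelow-resp {f = f} {g} f≈g f<n

  monic⇒degree : ∀ {n f} → MonicOfDegree n f → HasDegree n f
  monic⇒degree (top , f<n) = (λ e → 0≉1 (trans (sym e) top)) , f<n

  monic-degree-unique : ∀ {m n f} → MonicOfDegree m f → MonicOfDegree n f → m ≡ n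
  monic-degree-unique {f = f} f-m f-n = degree-unique {f = f} (monic⇒degree {f = f} f-m) (monic⇒degree {f = f} f-n)

  infix 4 _≈[]?
  _≈[]? : ∀ f → Dec (f ≈ₚ [])
  f ≈[]? with degree-view f
  ... | inj₁ f≈0             = yes f≈0
  ... | inj₂ (n , top≉0 , _) = no λ f≈0 → top≉0 (f≈0 n)

  -- A nonzero `h` of degree n would give the product degree d + n, which is not below `d`. This is
  -- the source of both cancellation and the uniqueness of remainders.
  monic-multiple-small : ∀ {d} P h → MonicOfDegree d P → DegreeBelow d (P *ₚ h) → h ≈ₚ []
  monic-multiple-small {d} P h P-monic Ph<d with degree-view h
  ... | inj₁ h≈0       = h≈0
  ... | inj₂ (n , h-n) = contradiction
    (degree-< {f = P *ₚ h} (degree-* P h (monic⇒degree {f = P} P-monic) h-n) Ph<d) (ℕₚ.m+n≮m d n)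

  private
    difference≈0 : ∀ f g → f +ₚ (-ₚ g) ≈ₚ [] → f ≈ₚ g
    difference≈0 f g = Pₚ.x∙y⁻¹≈ε⇒x≈y f g

  monic-cancelˡ : ∀ {d} P f g → MonicOfDegree d P → P *ₚ f ≈ₚ P *ₚ g → f ≈ₚ g
  monic-cancelˡ P f g P-monic Pf≈Pg = difference≈0 f g
    (monic-multiple-small P (f +ₚ (-ₚ g)) P-monic λ i _ → trans (*ₚ-difference P f g i)
      (Pₚ.x≈y⇒x∙y⁻¹≈ε {P *ₚ f} {P *ₚ g} Pf≈Pg i))

  -- A quotient with zero remainder is unique, hence a nonzero remainder refutes divisibility.
  monic-∣? : ∀ {d} P → MonicOfDegree d P → ∀ f → Dec (P ∣ₚ f)
  monic-∣? {d} P P-monic f with divMod P P-monic f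
  ... | k , r , f≈Pk+r , r<d with r ≈[]?
  ...   | yes r≈0 = yes (k , +ₚ-≈[] {f} {P *ₚ k} {r} f≈Pk+r r≈0)
  ...   | no r≉0 = no λ (h , Ph≈f) → r≉0
    (let
      P[h-k]≈r : P *ₚ (h +ₚ (-ₚ k)) ≈ₚ r
      P[h-k]≈r = begin
        P *ₚ (h +ₚ (-ₚ k))                     ≈⟨ *ₚ-difference P h k ⟩
        P *ₚ h +ₚ (-ₚ (P *ₚ k))
          ≈⟨ +ₚ-cong {P *ₚ h} {P *ₚ k +ₚ r} { -ₚ (P *ₚ k)} (λ i → trans (Ph≈f i) (f≈Pk+r i)) (λ _ → refl) ⟩
        (P *ₚ k +ₚ r) +ₚ (-ₚ (P *ₚ k))         ≈⟨ Pₚ.xyx⁻¹≈y (P *ₚ k) r ⟩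
        r                                      ∎
      h-k≈0 = monic-multiple-small P (h +ₚ (-ₚ k)) P-monic
        (degreeBelow-resp {f = r} {P *ₚ (h +ₚ (-ₚ k))} (λ i → sym (P[h-k]≈r i)) r<d)
    in λ i → trans (sym (P[h-k]≈r i)) (trans (*ₚ-congˡ P {h +ₚ (-ₚ k)} {[]} h-k≈0 i) (*ₚ-zeroʳ P i)))
    where open ≈-Reasoning polySetoid

  -- Over a field degrees add, and the leading coefficient of `h` multiplied by 1 is that of `f`.
  monic-cofactor : ∀ {d n} P h f → MonicOfDegree d P → MonicOfDegree n f → P *ₚ h ≈ₚ f →
                   ∃ λ e → d ℕ.+ e ≡ n × MonicOfDegree e h
  monic-cofactor {d} {n} P h f P-monic f-monic Ph≈f with degree-view h
  ... | inj₁ h≈0 = contradiction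
    (trans (trans (sym (*ₚ-zeroʳ P n)) (trans (sym (*ₚ-congˡ P {h} {[]} h≈0 n)) (Ph≈f n))) (proj₁ f-monic)) 0≉1
  ... | inj₂ (e , h-e) = e , d+e≡n , (begin
    coeff h e                       ≈⟨ *-identityˡ _ ⟨
    1# * coeff h e                  ≈⟨ *-congʳ (proj₁ P-monic) ⟨
    coeff P d * coeff h e           ≈⟨ coeff-top-* {d} {e} P h (proj₂ P-monic) (proj₂ h-e) ⟨
    coeff (P *ₚ h) (d ℕ.+ e)        ≡⟨ ≡.cong (coeff (P *ₚ h)) d+e≡n ⟩
    coeff (P *ₚ h) n                ≈⟨ Ph≈f n ⟩
    coeff f n                       ≈⟨ proj₁ f-monic ⟩
    1#                              ∎) , proj₂ h-e
    where
    open ≈-Reasoning setoid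
    d+e≡n = degree-unique {f = f}
      (degree-resp {f = P *ₚ h} {f} Ph≈f (degree-* P h (monic⇒degree {f = P} P-monic) h-e))
      (monic⇒degree {f = f} f-monic)

  ·-monic : ∀ {n} a f → a * coeff f n ≈ 1# → DegreeBelow (suc n) f → MonicOfDegree n (a ·ₚ f)
  ·-monic a f top f<n = trans (coeff-· a f _) top ,
    λ i n<i → trans (coeff-· a f i) (trans (*-congˡ (f<n i n<i)) (zeroʳ a))

  -- Irreducibility of monic polynomials, tested on monic factorisations only.
  Unsplittable : Poly → Set _
  Unsplittable P = ∀ {m n} f g → MonicOfDegree m f → MonicOfDegree n g → f *ₚ g ≈ₚ P → m ≡ 0 ⊎ n ≡ 0

  -- Euclid's algorithm on (P , r): a nonzero remainder of P modulo r has smaller degree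
  -- than r, and P still divides its product with g.
  private
    euclid-remainder : ∀ {d} P g → MonicOfDegree d P → Unsplittable P →
      ∀ e r → e ℕ.≤ d → DegreeBelow e r → ¬ r ≈ₚ [] → P ∣ₚ r *ₚ g → P ∣ₚ g
    euclid-remainder P g P-monic P-unsplit zero r e≤d r<e r≉0 P∣rg =
      contradiction (λ i → r<e i z≤n) r≉0
    euclid-remainder {d} P g P-monic P-unsplit (suc e) r e<d r<e r≉0 P∣rg with degree-view r
    ... | inj₁ r≈0 = contradiction r≈0 r≉0
    ... | inj₂ (n , r-n@(top≉0 , r<n)) with inverse (coeff r n) top≉0
    -- Division needs a monic divisor, so `r` is scaled by the inverse of its leading coefficient;
    -- divisibility by `P` survives the scaling.
    ...   | a , ra≈1 with divMod (a ·ₚ r) (·-monic a r (trans (*-comm _ _) ra≈1) r<n) P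
    ...     | k , t , P≈sk+t , t<n = continue (t ≈[]?)
      where
      s = a ·ₚ r
      n<d : n ℕ.< d
      n<d = ℕₚ.≤-trans (degree-< {f = r} r-n r<e) e<d
      s-monic : MonicOfDegree n s
      s-monic = ·-monic a r (trans (*-comm _ _) ra≈1) r<n
      P∣sg : P ∣ₚ s *ₚ g
      P∣sg = let h , Ph≈rg = P∣rg in a ·ₚ h , (begin
        P *ₚ (a ·ₚ h)    ≈⟨ *ₚ-comm P (a ·ₚ h) ⟩
        (a ·ₚ h) *ₚ P    ≈⟨ ·-*ₚ-assoc a h P ⟩
        a ·ₚ (h *ₚ P)
          ≈⟨ ·-cong {a} {a} {h *ₚ P} {r *ₚ g} refl (λ i → trans (*ₚ-comm h P i) (Ph≈rg i)) ⟩
        a ·ₚ (r *ₚ g)    ≈⟨ ·-*ₚ-assoc a r g ⟨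
        s *ₚ g           ∎)
        where open ≈-Reasoning polySetoid
      P∣skg : P ∣ₚ (s *ₚ k) *ₚ g
      P∣skg = ∣ₚ-respʳ {P} {(s *ₚ g) *ₚ k} {(s *ₚ k) *ₚ g} (begin
        (s *ₚ g) *ₚ k    ≈⟨ *ₚ-assoc s g k ⟩
        s *ₚ (g *ₚ k)    ≈⟨ *ₚ-congˡ s {g *ₚ k} {k *ₚ g} (*ₚ-comm g k) ⟩
        s *ₚ (k *ₚ g)    ≈⟨ *ₚ-assoc s k g ⟨
        (s *ₚ k) *ₚ g    ∎)
        (∣ₚ-*ʳ {P} {s *ₚ g} k P∣sg)
        where open ≈-Reasoning polySetoid
      P∣tg : P ∣ₚ t *ₚ g
      P∣tg = ∣ₚ-difference {P} {P *ₚ g} {(s *ₚ k) *ₚ g} {t *ₚ g}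
        (λ i → trans (*ₚ-congʳ {P} {s *ₚ k +ₚ t} g P≈sk+t i) (*ₚ-distribʳ g (s *ₚ k) t i))
        (g , λ _ → refl) P∣skg
      sk≈P : t ≈ₚ [] → s *ₚ k ≈ₚ P
      sk≈P = +ₚ-≈[] {P} {s *ₚ k} {t} P≈sk+t
      continue : Dec (t ≈ₚ []) → P ∣ₚ g
      -- The bound decreases: `t` has degree below n, and n ≤ `e`.
      continue (no t≉0) = euclid-remainder P g P-monic P-unsplit e t (ℕₚ.<⇒≤ e<d)
        (degreeBelow-mono t (ℕ.s≤s⁻¹ (degree-< {f = r} r-n r<e)) t<n) t≉0 P∣tg
      -- Now `s` is a monic factor of `P`. Either `s` is 1, so that `P` divides `g` already, or the
      -- cofactor has degree 0 and `s` has the full degree `d`, which the strict bound on `r`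
      -- excludes.
      continue (yes t≈0) with m , n+m≡d , k-monic ← monic-cofactor s k P s-monic P-monic (sk≈P t≈0)
        with P-unsplit s k s-monic k-monic (sk≈P t≈0)
      ... | inj₁ ≡.refl = ∣ₚ-respʳ {P} {s *ₚ g} {g} (λ i → trans
              (*ₚ-congʳ {s} {1# ∷ []} g (monic-0 {s} s-monic) i) (*ₚ-identityˡ g i)) P∣sg
      ... | inj₂ ≡.refl = contradiction (≡.trans (≡.sym (ℕₚ.+-identityʳ n)) n+m≡d) (ℕₚ.<⇒≢ n<d)

  -- Reducing `f` modulo `P` preserves the divisibility of the product and brings the degree below
  -- `d`, where the descent starts. The descent carries the statement that `P` divides a multiple of
  -- `g` instead of Bézout coefficients.
  euclid : ∀ {d} P f g → MonicOfDegree d P → Unsplittable P → P ∣ₚ f *ₚ g → P ∣ₚ f ⊎ P ∣ₚ g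
  euclid {d} P f g P-monic P-unsplit P∣fg with monic-∣? P P-monic f
  ... | yes P∣f = inj₁ P∣f
  ... | no P∤f with divMod P P-monic f
  ...   | k , r , f≈Pk+r , r<d = inj₂ (euclid-remainder P g P-monic P-unsplit d r ℕₚ.≤-refl r<d
    (λ r≈0 → P∤f (k , +ₚ-≈[] {f} {P *ₚ k} {r} f≈Pk+r r≈0))
    (∣ₚ-difference {P} {f *ₚ g} {(P *ₚ k) *ₚ g} {r *ₚ g}
      (λ i → trans (*ₚ-congʳ {f} {P *ₚ k +ₚ r} g f≈Pk+r i) (*ₚ-distribʳ g (P *ₚ k) r i))
      P∣fg (∣ₚ-*ʳ {P} {P *ₚ k} g (k , λ _ → refl))))

-- Integer power series and multiplication by factors 1 - ε T ^ d

-- A sequence stands for its generating series, shift d for multiplication by T ^ d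
-- and Δ ε d for multiplication by 1 - ε T ^ d.
Sequence : Set
Sequence = ℕ → ℤ

shift : ℕ → Sequence → Sequence
shift zero    s n       = s n
shift (suc d) s zero    = 0ℤ
shift (suc d) s (suc n) = shift d s n

Δ : ℤ → ℕ → Sequence → Sequence
Δ ε d s n = s n ℤ.- ε ℤ.* shift d s n

δ : Sequence
δ zero    = 1ℤ
δ (suc _) = 0ℤ

shift-cong : ∀ d {s t} → s ≗ t → shift d s ≗ shift d t
shift-cong zero    s≗t n       = s≗t n
shift-cong (suc d) s≗t zero    = ≡.refl
shift-cong (suc d) s≗t (suc n) = shift-cong d s≗t n

shift-shift : ∀ d e s → shift d (shift e s) ≗ shift (d ℕ.+ e) s
shift-shift zero    e s n       = ≡.refl
shift-shift (suc d) e s zero    = ≡.refl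
shift-shift (suc d) e s (suc n) = shift-shift d e s n

shift-comm : ∀ d e s → shift d (shift e s) ≗ shift e (shift d s)
shift-comm d e s n = ≡.trans (shift-shift d e s n)
  (≡.trans (cong (λ k → shift k s n) (ℕₚ.+-comm d e)) (≡.sym (shift-shift e d s n)))

shift-< : ∀ {d n} s → n ℕ.< d → shift d s n ≡ 0ℤ
shift-< {suc d} {zero}  s n<d       = ≡.refl
shift-< {suc d} {suc n} s (s≤s n<d) = shift-< s n<d

shift-+ : ∀ d s n → shift d s (d ℕ.+ n) ≡ s n
shift-+ zero    s n = ≡.refl
shift-+ (suc d) s n = shift-+ d s n

shift-Δ : ∀ d ε e s n → shift d (Δ ε e s) n ≡ shift d s n ℤ.- ε ℤ.* shift d (shift e s) n
shift-Δ zero    ε e s n       = ≡.refl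
shift-Δ (suc d) ε e s zero    = lemma ε
  where
  lemma : ∀ ε → 0ℤ ≡ 0ℤ ℤ.- ε ℤ.* 0ℤ
  lemma = solve-∀
shift-Δ (suc d) ε e s (suc n) = shift-Δ d ε e s n

Δ-cong : ∀ ε d {s t} → s ≗ t → Δ ε d s ≗ Δ ε d t
Δ-cong ε d s≗t n = cong₂ (λ x y → x ℤ.- ε ℤ.* y) (s≗t n) (shift-cong d s≗t n)

Δ-comm : ∀ ε d ε′ e s → Δ ε d (Δ ε′ e s) ≗ Δ ε′ e (Δ ε d s)
Δ-comm ε d ε′ e s n = begin
  (s n ℤ.- ε′ ℤ.* shift e s n) ℤ.- ε ℤ.* shift d (Δ ε′ e s) n
    ≡⟨ cong (λ x → (s n ℤ.- ε′ ℤ.* shift e s n) ℤ.- ε ℤ.* x) (shift-Δ d ε′ e s n) ⟩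
  (s n ℤ.- ε′ ℤ.* shift e s n) ℤ.- ε ℤ.* (shift d s n ℤ.- ε′ ℤ.* shift d (shift e s) n)
    ≡⟨ cong (λ x → (s n ℤ.- ε′ ℤ.* shift e s n) ℤ.- ε ℤ.* (shift d s n ℤ.- ε′ ℤ.* x)) (shift-comm d e s n) ⟩
  (s n ℤ.- ε′ ℤ.* shift e s n) ℤ.- ε ℤ.* (shift d s n ℤ.- ε′ ℤ.* shift e (shift d s) n)
    ≡⟨ rearrange ε ε′ (s n) (shift e s n) (shift d s n) (shift e (shift d s) n) ⟩
  (s n ℤ.- ε ℤ.* shift d s n) ℤ.- ε′ ℤ.* (shift e s n ℤ.- ε ℤ.* shift e (shift d s) n)
    ≡⟨ cong (λ x → (s n ℤ.- ε ℤ.* shift d s n) ℤ.- ε′ ℤ.* x) (shift-Δ e ε d s n) ⟨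
  (s n ℤ.- ε ℤ.* shift d s n) ℤ.- ε′ ℤ.* shift e (Δ ε d s) n ∎
  where
  open ≡.≡-Reasoning
  rearrange : ∀ ε ε′ a b c d → (a ℤ.- ε′ ℤ.* b) ℤ.- ε ℤ.* (c ℤ.- ε′ ℤ.* d) ≡ (a ℤ.- ε ℤ.* c) ℤ.- ε′ ℤ.* (b ℤ.- ε ℤ.* d)
  rearrange = solve-∀

Δ-zero : ∀ d s → Δ 0ℤ d s ≗ s
Δ-zero d s n = lemma (s n) (shift d s n)
  where
  lemma : ∀ a b → a ℤ.- 0ℤ ℤ.* b ≡ a
  lemma = solve-∀

-- (1 - T ^ d) (1 + T ^ d) = 1 - T ^ (2 d)
Δ-conjugate : ∀ d s → Δ 1ℤ d (Δ -1ℤ d s) ≗ Δ 1ℤ (d ℕ.+ d) s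
Δ-conjugate d s n = begin
  (s n ℤ.- -1ℤ ℤ.* shift d s n) ℤ.- 1ℤ ℤ.* shift d (Δ -1ℤ d s) n
    ≡⟨ cong (λ x → (s n ℤ.- -1ℤ ℤ.* shift d s n) ℤ.- 1ℤ ℤ.* x) (shift-Δ d -1ℤ d s n) ⟩
  (s n ℤ.- -1ℤ ℤ.* shift d s n) ℤ.- 1ℤ ℤ.* (shift d s n ℤ.- -1ℤ ℤ.* shift d (shift d s) n)
    ≡⟨ rearrange (s n) (shift d s n) (shift d (shift d s) n) ⟩
  s n ℤ.- 1ℤ ℤ.* shift d (shift d s) n
    ≡⟨ cong (λ x → s n ℤ.- 1ℤ ℤ.* x) (shift-shift d d s n) ⟩
  s n ℤ.- 1ℤ ℤ.* shift (d ℕ.+ d) s n ∎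
  where
  open ≡.≡-Reasoning
  rearrange : ∀ a b c → (a ℤ.- -1ℤ ℤ.* b) ℤ.- 1ℤ ℤ.* (b ℤ.- -1ℤ ℤ.* c) ≡ a ℤ.- 1ℤ ℤ.* c
  rearrange = solve-∀

Δ^ : ℤ → ℕ → ℕ → Sequence → Sequence
Δ^ ε d zero    s = s
Δ^ ε d (suc k) s = Δ ε d (Δ^ ε d k s)

Δ^-cong : ∀ ε d k {s t} → s ≗ t → Δ^ ε d k s ≗ Δ^ ε d k t
Δ^-cong ε d zero    s≗t = s≗t
Δ^-cong ε d (suc k) s≗t = Δ-cong ε d (Δ^-cong ε d k s≗t)

Δ^-+ : ∀ ε d k l s → Δ^ ε d (k ℕ.+ l) s ≗ Δ^ ε d k (Δ^ ε d l s)
Δ^-+ ε d zero    l s n = ≡.refl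
Δ^-+ ε d (suc k) l s   = Δ-cong ε d (Δ^-+ ε d k l s)

Δ-Δ^-comm : ∀ ε d ε′ e l s → Δ ε d (Δ^ ε′ e l s) ≗ Δ^ ε′ e l (Δ ε d s)
Δ-Δ^-comm ε d ε′ e zero    s n = ≡.refl
Δ-Δ^-comm ε d ε′ e (suc l) s n = ≡.trans (Δ-comm ε d ε′ e (Δ^ ε′ e l s) n)
  (Δ-cong ε′ e (Δ-Δ^-comm ε d ε′ e l s) n)

Δ^-comm : ∀ ε d k ε′ e l s → Δ^ ε d k (Δ^ ε′ e l s) ≗ Δ^ ε′ e l (Δ^ ε d k s)
Δ^-comm ε d zero    ε′ e l s n = ≡.refl
Δ^-comm ε d (suc k) ε′ e l s n = ≡.trans (Δ-cong ε d (Δ^-comm ε d k ε′ e l s) n)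
  (Δ-Δ^-comm ε d ε′ e l (Δ^ ε d k s) n)

Δ^-conjugate : ∀ d k s → Δ^ 1ℤ d k (Δ^ -1ℤ d k s) ≗ Δ^ 1ℤ (d ℕ.+ d) k s
Δ^-conjugate d zero    s n = ≡.refl
Δ^-conjugate d (suc k) s n = begin
  Δ 1ℤ d (Δ^ 1ℤ d k (Δ -1ℤ d (Δ^ -1ℤ d k s))) n
    ≡⟨ Δ-cong 1ℤ d (Δ-Δ^-comm -1ℤ d 1ℤ d k (Δ^ -1ℤ d k s)) n ⟨
  Δ 1ℤ d (Δ -1ℤ d (Δ^ 1ℤ d k (Δ^ -1ℤ d k s))) n  ≡⟨ Δ-conjugate d (Δ^ 1ℤ d k (Δ^ -1ℤ d k s)) n ⟩
  Δ 1ℤ (d ℕ.+ d) (Δ^ 1ℤ d k (Δ^ -1ℤ d k s)) n    ≡⟨ Δ-cong 1ℤ (d ℕ.+ d) (Δ^-conjugate d k s) n ⟩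
  Δ 1ℤ (d ℕ.+ d) (Δ^ 1ℤ (d ℕ.+ d) k s) n         ∎
  where open ≡.≡-Reasoning

-- The factor (1 - ε T ^ d) ^ k is 1 modulo T ^ d.
Δ^-< : ∀ ε {d n} k s → n ℕ.< d → Δ^ ε d k s n ≡ s n
Δ^-< ε zero    s n<d = ≡.refl
Δ^-< ε {d} {n} (suc k) s n<d = begin
  Δ^ ε d k s n ℤ.- ε ℤ.* shift d (Δ^ ε d k s) n
    ≡⟨ cong₂ (λ x y → x ℤ.- ε ℤ.* y) (Δ^-< ε k s n<d) (shift-< (Δ^ ε d k s) n<d) ⟩
  s n ℤ.- ε ℤ.* 0ℤ                               ≡⟨ lemma ε (s n) ⟩
  s n                                            ∎
  where
  open ≡.≡-Reasoning
  lemma : ∀ ε a → a ℤ.- ε ℤ.* 0ℤ ≡ a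
  lemma = solve-∀

-- Modulo T ^ (d + 1) the factor (1 - T ^ d) ^ k is 1 - k T ^ d, so only the constant term of `s`
-- meets the -k.
Δ^-diagonal : ∀ d k s → 0 ℕ.< d → s 0 ≡ 1ℤ → Δ^ 1ℤ d k s d ≡ s d ℤ.- + k
Δ^-diagonal d zero    s 0<d s0≡1 = ≡.sym (ℤₚ.+-identityʳ (s d))
Δ^-diagonal d (suc k) s 0<d s0≡1 = begin
  Δ^ 1ℤ d k s d ℤ.- 1ℤ ℤ.* shift d (Δ^ 1ℤ d k s) d
    ≡⟨ cong₂ (λ x y → x ℤ.- 1ℤ ℤ.* y) (Δ^-diagonal d k s 0<d s0≡1)
         (≡.trans (cong (shift d (Δ^ 1ℤ d k s)) (≡.sym (ℕₚ.+-identityʳ d)))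
           (≡.trans (shift-+ d (Δ^ 1ℤ d k s) 0) (≡.trans (Δ^-< 1ℤ k s 0<d) s0≡1))) ⟩
  (s d ℤ.- + k) ℤ.- 1ℤ ℤ.* 1ℤ
    ≡⟨ lemma (s d) (+ k) ⟩
  s d ℤ.- (1ℤ ℤ.+ + k) ∎
  where
  open ≡.≡-Reasoning
  lemma : ∀ a k → (a ℤ.- k) ℤ.- 1ℤ ℤ.* 1ℤ ≡ a ℤ.- (1ℤ ℤ.+ k)
  lemma = solve-∀

double : ℕ → ℕ
double n = n ℕ.+ n

-- From the sieved Euler product to the recursion for the counts

module EulerProduct
  -- Intended meaning: `G m` is the series of χ over the monic polynomials without irreducible
  -- factors of degree at most m, and `p d`, `c d` count the irreducibles of degree d with χ = 1 and
  -- χ = -1. Irreducibles with χ = 0 contribute the factor 1 and leave no trace in `G-suc`.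
  (G : ℕ → Sequence) (p c : ℕ → ℕ)
  (G-zero : G 0 ≗ Δ 1ℤ 1 δ)
  (G-suc  : ∀ m → G (suc m) ≗ Δ^ 1ℤ (suc m) (p (suc m)) (Δ^ -1ℤ (suc m) (c (suc m)) (G m)))
  (G-next : ∀ m → G m (suc m) ≡ + p (suc m) ℤ.- + c (suc m))
  where

  -- The product of (1 - T ^ (2 e)) ^ c e over k < e ≤ k + j.
  window : ℕ → ℕ → Sequence
  window k zero    = δ
  window k (suc j) = Δ^ 1ℤ (double (suc k)) (c (suc k)) (window (suc k) j)

  -- By definition a window opens at its lowest factor, which the even steps consume, whereas
  -- sieving adds factors at the top. The factors commute, so the two ends can be exchanged.
  window-snoc : ∀ k j {e} → e ≡ suc (k ℕ.+ j) → window k (suc j) ≗ Δ^ 1ℤ (double e) (c e) (window k j)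
  window-snoc k zero ≡.refl n = cong (λ e → Δ^ 1ℤ (double (suc e)) (c (suc e)) δ n) (≡.sym (ℕₚ.+-identityʳ k))
  window-snoc k (suc j) {e} e≡ n = begin
    Δ^ 1ℤ d (c (suc k)) (window (suc k) (suc j)) n
      ≡⟨ Δ^-cong 1ℤ d (c (suc k)) (window-snoc (suc k) j (≡.trans e≡ (cong suc (ℕₚ.+-suc k j)))) n ⟩
    Δ^ 1ℤ d (c (suc k)) (Δ^ 1ℤ (double e) (c e) (window (suc k) j)) n
      ≡⟨ Δ^-comm 1ℤ d (c (suc k)) 1ℤ (double e) (c e) (window (suc k) j) n ⟩
    Δ^ 1ℤ (double e) (c e) (window k (suc j)) n ∎
    where
    open ≡.≡-Reasoning
    d = double (suc k)

  window-< : ∀ k j {n} → n ℕ.< double (suc k) → window k j n ≡ δ n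
  window-< k zero    n<2k = ≡.refl
  window-< k (suc j) n<2k = ≡.trans (Δ^-< 1ℤ (c (suc k)) (window (suc k) j) n<2k)
    (window-< (suc k) j (ℕₚ.≤-trans n<2k (ℕₚ.+-mono-≤ (ℕₚ.n≤1+n (suc k)) (ℕₚ.n≤1+n (suc k)))))

  -- Only the lowest factor reaches this exponent; all others are 1 up to it.
  window-diagonal : ∀ k j → window k (suc j) (double (suc k)) ≡ ℤ.- + c (suc k)
  window-diagonal k j = begin
    Δ^ 1ℤ d (c (suc k)) w d
      ≡⟨ Δ^-diagonal d (c (suc k)) w (s≤s z≤n) (window-< (suc k) j (s≤s z≤n)) ⟩
    w d ℤ.- + c (suc k)
      ≡⟨ cong (ℤ._- + c (suc k)) (window-< (suc k) j (ℕₚ.+-mono-< (ℕₚ.n<1+n (suc k)) (ℕₚ.n<1+n (suc k)))) ⟩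
    0ℤ ℤ.- + c (suc k)           ≡⟨ ℤₚ.+-identityˡ _ ⟩
    ℤ.- + c (suc k)                ∎
    where
    open ≡.≡-Reasoning
    d = double (suc k)
    w = window (suc k) j

  difference⇒sum : ∀ {x y z} → + x ℤ.- + y ≡ ℤ.- + z → y ≡ x ℕ.+ z
  difference⇒sum {x} {y} {z} e = ℤₚ.+-injective (begin
    + y                              ≡⟨ lemma (+ x) (+ y) ⟩
    + x ℤ.- (+ x ℤ.- + y)            ≡⟨ cong (ℤ._-_ (+ x)) e ⟩
    + x ℤ.- (ℤ.- + z)                  ≡⟨ cong (ℤ._+_ (+ x)) (ℤₚ.neg-involutive (+ z)) ⟩
    + x ℤ.+ + z                      ∎)
    where
    open ≡.≡-Reasoning
    lemma : ∀ a b → b ≡ a ℤ.- (a ℤ.- b)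
    lemma = solve-∀

  -- Absorbs a surplus of z factors 1 - T ^ d, which makes up for c d = p d + z.
  G-collapse : ∀ m z s → G m ≗ Δ^ 1ℤ (suc m) z s → c (suc m) ≡ p (suc m) ℕ.+ z →
               G (suc m) ≗ Δ^ 1ℤ (double (suc m)) (c (suc m)) s
  G-collapse m z s Gm≗ c≡p+z n = begin
    G (suc m) n                                       ≡⟨ G-suc m n ⟩
    Δ^ 1ℤ d p′ (Δ^ -1ℤ d c′ (G m)) n                  ≡⟨ Δ^-cong 1ℤ d p′ (Δ^-cong -1ℤ d c′ Gm≗) n ⟩
    Δ^ 1ℤ d p′ (Δ^ -1ℤ d c′ (Δ^ 1ℤ d z s)) n
      ≡⟨ Δ^-cong 1ℤ d p′ (Δ^-comm -1ℤ d c′ 1ℤ d z s) n ⟩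
    Δ^ 1ℤ d p′ (Δ^ 1ℤ d z (Δ^ -1ℤ d c′ s)) n          ≡⟨ Δ^-+ 1ℤ d p′ z (Δ^ -1ℤ d c′ s) n ⟨
    Δ^ 1ℤ d (p′ ℕ.+ z) (Δ^ -1ℤ d c′ s) n
      ≡⟨ cong (λ k → Δ^ 1ℤ d k (Δ^ -1ℤ d c′ s) n) c≡p+z ⟨
    Δ^ 1ℤ d c′ (Δ^ -1ℤ d c′ s) n                      ≡⟨ Δ^-conjugate d c′ s n ⟩
    Δ^ 1ℤ (double d) c′ s n                           ∎
    where
    open ≡.≡-Reasoning
    d  = suc m
    p′ = p d
    c′ = c d

  mutual
    -- For m = 2 k + 1 the range m / 2 < e ≤ m is k < e ≤ k + (k + 1); for m = 2 k + 2 it is k + 1 <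
    -- e ≤ (k + 1) + (k + 1). Passing to an odd degree above 1 meets no surplus. Passing to the even
    -- degree 2 k + 2 uses up the lowest factor of the window, whose exponent is that very degree.
    G-odd : ∀ k → G (suc (double k)) ≗ window k (suc k)
    -- Here the L-series 1 - T is itself the surplus of one factor, whence `c 1` is `p 1` plus 1.
    G-odd zero = G-collapse 0 1 δ G-zero (difference⇒sum (≡.trans (≡.sym (G-next 0)) (G-zero 1)))
    G-odd (suc k) n = ≡.trans
      (G-collapse (double (suc k)) 0 (window (suc k) (suc k)) (G-even k)
        (≡.trans (c≡p-odd k) (≡.sym (ℕₚ.+-identityʳ _))) n)
      (≡.sym (window-snoc (suc k) (suc k) ≡.refl n))

    G-even : ∀ k → G (double (suc k)) ≗ window (suc k) (suc k)
    G-even k n = ≡.trans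
      (≡.trans (cong (λ e → G e n) 2k)
        (G-collapse (suc (double k)) (c (suc k)) (window (suc k) k)
          (λ i → ≡.trans (G-odd k i) (cong (λ e → Δ^ 1ℤ e (c (suc k)) (window (suc k) k) i) 2k))
          (≡.subst (λ e → c e ≡ p e ℕ.+ c (suc k)) 2k (c≡p-even k)) n))
      (≡.sym (window-snoc (suc k) k ≡.refl n))
      where
      2k : double (suc k) ≡ suc (suc (double k))
      2k = cong suc (ℕₚ.+-suc k k)

    -- The exponent 2 k + 3 lies strictly between 0 and 2 k + 4, the lowest exponent occurring in
    -- the window.
    c≡p-odd : ∀ k → c (suc (double (suc k))) ≡ p (suc (double (suc k)))
    c≡p-odd k = ≡.sym (ℤₚ.+-injective (ℤₚ.i-j≡0⇒i≡j _ _ (begin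
      _                                                ≡⟨ G-next (double (suc k)) ⟨
      G (double (suc k)) (suc (double (suc k)))        ≡⟨ G-even k _ ⟩
      window (suc k) (suc k) (suc (double (suc k)))
        ≡⟨ window-< (suc k) (suc k) (s≤s (ℕₚ.≤-reflexive (≡.sym (ℕₚ.+-suc (suc k) (suc k))))) ⟩
      0ℤ                                               ∎)))
      where open ≡.≡-Reasoning

    -- The exponent 2 k + 2 is exactly the lowest one in the window, so the coefficient there is
    -- minus the multiplicity of that factor.
    c≡p-even : ∀ k → c (double (suc k)) ≡ p (double (suc k)) ℕ.+ c (suc k)
    c≡p-even k = difference⇒sum (begin
      + p d ℤ.- + c d
        ≡⟨ ≡.subst (λ e → G (suc (double k)) e ≡ + p e ℤ.- + c e) (≡.sym 2k) (G-next (suc (double k))) ⟨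
      G (suc (double k)) d                     ≡⟨ G-odd k d ⟩
      window k (suc k) d                       ≡⟨ window-diagonal k k ⟩
      ℤ.- + c (suc k)                            ∎)
      where
      open ≡.≡-Reasoning
      d = double (suc k)
      2k : double (suc k) ≡ suc (suc (double k))
      2k = cong suc (ℕₚ.+-suc k k)

-- The quadratic character of a finite field of odd order

odd⇒1+double : ∀ {q} → 2 ∤ q → ∃ λ h → q ≡ suc (h ℕ.+ h)
odd⇒1+double {q} 2∤q with q % 2 in q%2≡ | m%n<n q 2
... | 0 | _ = contradiction (m%n≡0⇒n∣m q 2 q%2≡) 2∤q
... | 1 | _ = q / 2 , (begin
  q                     ≡⟨ m≡m%n+[m/n]*n q 2 ⟩
  q % 2 ℕ.+ q / 2 ℕ.* 2 ≡⟨ cong₂ ℕ._+_ q%2≡ (ℕₚ.*-comm (q / 2) 2) ⟩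
  suc (q / 2 ℕ.+ (q / 2 ℕ.+ 0)) ≡⟨ cong (λ k → suc (q / 2 ℕ.+ k)) (ℕₚ.+-identityʳ (q / 2)) ⟩
  suc (q / 2 ℕ.+ q / 2) ∎)
  where open ≡.≡-Reasoning
... | suc (suc _) | s≤s (s≤s ())

double/2 : ∀ h → (h ℕ.+ h) / 2 ≡ h
double/2 h = ≡.trans (cong (_/ 2) (≡.trans (cong (h ℕ.+_) (≡.sym (ℕₚ.+-identityʳ h))) (ℕₚ.*-comm 2 h))) (m*n/n≡m h 2)

x≡-x⇒x≡0 : ∀ x → x ≡ ℤ.- x → x ≡ 0ℤ
x≡-x⇒x≡0 (ℤ.+ 0)        e = ≡.refl
x≡-x⇒x≡0 (ℤ.+ (suc n))  ()
x≡-x⇒x≡0 (ℤ.-[1+ n ])   ()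

module _ {c ℓ} (M : CommutativeMonoid c ℓ) where

  open CommutativeMonoid M
  open CommutativeMonoidMult M using () renaming (_×_ to _×ᴹ_)
  open import Algebra.Properties.CommutativeSemigroup commutativeSemigroup using (interchange)

  -- Stated for monoids because it serves twice: over addition it leads to q × 1 = 0, over
  -- multiplication to Fermat's theorem.
  product-translate : ∀ a xs → foldr _∙_ ε (map (a ∙_) xs) ≈ (length xs ×ᴹ a) ∙ foldr _∙_ ε xs
  product-translate a []       = sym (identityˡ ε)
  product-translate a (x ∷ xs) = trans (∙-congˡ (product-translate a xs)) (interchange a x _ _)

module QuadraticCharacter {q c ℓ} (𝔽 : FiniteField q c ℓ) (2∤q : 2 ∤ q) where

  open FiniteField 𝔽
  open Polynomial commutativeRing
  open FiniteFieldPolynomials 𝔽 using (_≈?_; cancel; *-≉0)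
  open RingProperties ring
  open Membership setoid using (_∈_)
  open Permutation setoid using (_↭_)
  open Unique setoid using (Unique)
  open UniqueLists setoid
  open Exp commutativeSemiring using (_^_; ^-distrib-*; ^-homo-*; ^-congˡ)
  open CommutativeMonoidMult +-commutativeMonoid using (×-homo-+; ×-distrib-+; ×-congʳ) renaming (_×_ to _×′_)

  private
    module F = Inverse size
    h = proj₁ (odd⇒1+double 2∤q)
    q≡1+2h : q ≡ suc (h ℕ.+ h)
    q≡1+2h = proj₂ (odd⇒1+double 2∤q)

    listing : List Carrier
    listing = tabulate F.from

    listing! : Unique listing
    listing! = Uniqueₚ.tabulate⁺ setoid λ {i} {j} e →
      ≡.trans (≡.sym (F.strictlyInverseˡ i)) (≡.trans (F.to-cong e) (F.strictlyInverseˡ j))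

    ∈-listing : ∀ x → x ∈ listing
    ∈-listing x = Membershipₚ.∈-resp-≈ setoid (F.strictlyInverseʳ x) (Membershipₚ.∈-tabulate⁺ setoid (F.to x))

    ≉0-resp : ∀ {x y} → x ≈ y → ¬ x ≈ 0# → ¬ y ≈ 0#
    ≉0-resp x≈y x≉0 y≈0 = x≉0 (trans x≈y y≈0)

    nonzero? = λ x → ¬? (x ≈? 0#)

  nonzeros : List Carrier
  nonzeros = filter nonzero? listing

  nonzeros≉0 : All (λ x → ¬ x ≈ 0#) nonzeros
  nonzeros≉0 = Allₚ.all-filter nonzero? listing

  nonzeros! : Unique nonzeros
  nonzeros! = Uniqueₚ.filter⁺ setoid nonzero? listing!

  ∈-nonzeros : ∀ {x} → ¬ x ≈ 0# → x ∈ nonzeros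
  ∈-nonzeros {x} x≉0 = Membershipₚ.∈-filter⁺ setoid nonzero? ≉0-resp (∈-listing x) x≉0

  -- Zero is put in front so that a sum over the field splits into its term at zero and the sum over
  -- the units.
  elements : List Carrier
  elements = 0# ∷ nonzeros

  elements! : Unique elements
  elements! = All.map (λ x≉0 0≈x → x≉0 (sym 0≈x)) nonzeros≉0 ∷ nonzeros!

  ∈-elements : ∀ x → x ∈ elements
  ∈-elements x with x ≈? 0#
  ... | yes x≈0 = here x≈0
  ... | no x≉0  = there (∈-nonzeros x≉0)

  length-elements : length elements ≡ q
  length-elements = ≡.trans
    (Permutationₚ.xs↭ys⇒|xs|≡|ys| setoid (unique-⊆-⊇⇒↭ elements! listing!
      (All.universal ∈-listing elements) (All.universal ∈-elements listing)))
    (List.length-tabulate F.from)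

  length-nonzeros : length nonzeros ≡ h ℕ.+ h
  length-nonzeros = ℕₚ.suc-injective (≡.trans length-elements q≡1+2h)

  injective⇒↭ : ∀ φ → (∀ {x y} → φ x ≈ φ y → x ≈ y) → map φ elements ↭ elements
  injective⇒↭ φ φ-injective = unique-⊆∧length⇒↭ (Uniqueₚ.map⁺ setoid setoid φ-injective elements!)
    (All.universal ∈-elements (map φ elements)) (ℕₚ.≤-reflexive (≡.sym (List.length-map φ elements)))

  -- Translating the sum of all elements by 1 does not change it.
  q×1≈0 : q ×′ 1# ≈ 0#
  q×1≈0 = +-cancelʳ (foldr _+_ 0# elements) _ _ (begin
    q ×′ 1# + foldr _+_ 0# elements
      ≡⟨ cong (λ k → k ×′ 1# + foldr _+_ 0# elements) length-elements ⟨
    length elements ×′ 1# + foldr _+_ 0# elements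
      ≈⟨ product-translate +-commutativeMonoid 1# elements ⟨
    foldr _+_ 0# (map (λ x → 1# + x) elements)
      ≈⟨ Permutationₚ.foldr-commMonoid setoid +-isCommutativeMonoid (injective⇒↭ (λ x → 1# + x) (+-cancelˡ 1# _ _)) ⟩
    foldr _+_ 0# elements                          ≈⟨ +-identityˡ _ ⟨
    0# + foldr _+_ 0# elements                     ∎)
    where open ≈-Reasoning setoid

  -- The characteristic is odd: if 1 + 1 were 0, the sum of q = 2 h + 1 ones would be 1, but it is
  -- 0.
  1≉-1 : ¬ 1# ≈ - 1#
  1≉-1 1≈-1 = 0≉1 (begin
    0#                            ≈⟨ q×1≈0 ⟨
    q ×′ 1#                       ≡⟨ cong (_×′ 1#) q≡1+2h ⟩
    1# + (h ℕ.+ h) ×′ 1#          ≈⟨ +-congˡ (×-homo-+ 1# h h) ⟩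
    1# + (h ×′ 1# + h ×′ 1#)      ≈⟨ +-congˡ (×-distrib-+ 1# 1# h) ⟨
    1# + h ×′ (1# + 1#)           ≈⟨ +-congˡ (×-congʳ h (trans (+-congˡ 1≈-1) (-‿inverseʳ 1#))) ⟩
    1# + h ×′ 0#                  ≈⟨ +-congˡ (h×0 h) ⟩
    1# + 0#                       ≈⟨ +-identityʳ 1# ⟩
    1#                            ∎)
    where
    open ≈-Reasoning setoid
    h×0 : ∀ h → h ×′ 0# ≈ 0#
    h×0 zero    = refl
    h×0 (suc h) = trans (+-identityˡ _) (h×0 h)

  *-cancel : ∀ {a x y} → ¬ a ≈ 0# → a * x ≈ a * y → x ≈ y
  *-cancel {a} {x} {y} a≉0 ax≈ay = x∙y⁻¹≈ε⇒x≈y x y (cancel a≉0 (trans (x[y-z]≈xy-xz a x y) (x≈y⇒x∙y⁻¹≈ε ax≈ay)))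

  -- Multiplication by `a` permutes the q - 1 = 2 h nonzero elements, and their product is nonzero
  -- and can be cancelled.
  fermat : ∀ {a} → ¬ a ≈ 0# → a ^ (h ℕ.+ h) ≈ 1#
  fermat {a} a≉0 = *-cancel (product≉0 nonzeros≉0) (begin
    Π * a ^ (h ℕ.+ h)               ≡⟨ cong (λ k → Π * a ^ k) length-nonzeros ⟨
    Π * a ^ length nonzeros         ≈⟨ *-comm _ _ ⟩
    a ^ length nonzeros * Π         ≈⟨ product-translate *-commutativeMonoid a nonzeros ⟨
    foldr _*_ 1# (map (a *_) nonzeros)
      ≈⟨ Permutationₚ.foldr-commMonoid setoid *-isCommutativeMonoid translate ⟩
    Π                               ≈⟨ *-identityʳ Π ⟨
    Π * 1#                          ∎)
    where
    open ≈-Reasoning setoid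
    Π = foldr _*_ 1# nonzeros
    product≉0 : ∀ {xs} → All (λ x → ¬ x ≈ 0#) xs → ¬ foldr _*_ 1# xs ≈ 0#
    product≉0 []           e = 0≉1 (sym e)
    product≉0 (x≉0 ∷ xs≉0) e = *-≉0 x≉0 (product≉0 xs≉0) e
    translate : map (a *_) nonzeros ↭ nonzeros
    translate = unique-⊆∧length⇒↭ (Uniqueₚ.map⁺ setoid setoid (*-cancel a≉0) nonzeros!)
      (Allₚ.map⁺ (All.map (λ x≉0 → ∈-nonzeros (*-≉0 a≉0 x≉0)) nonzeros≉0))
      (ℕₚ.≤-reflexive (≡.sym (List.length-map (a *_) nonzeros)))

  -- Horner's scheme: the coefficients of (f x - f a) / (x - a) for f = b ∷ f′.
  horner : Carrier → Poly → Poly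
  horner a []      = []
  horner a (b ∷ f) = eval (b ∷ f) a ∷ horner a f

  length-horner : ∀ a f → length (horner a f) ≡ length f
  length-horner a []      = ≡.refl
  length-horner a (b ∷ f) = cong suc (length-horner a f)

  -- x f(x) - a f(a) = (x - a) (horner a f)(x), with both sides moved so that no subtraction occurs
  horner-correct : ∀ a f x → x * eval f x + a * eval (horner a f) x ≈ a * eval f a + x * eval (horner a f) x
  horner-correct a []      x = +-comm _ _
  horner-correct a (b ∷ f) x = begin
    x * (b + x * F) + a * (b + a * A + x * H)
      ≈⟨ solve 6 (λ a b x F A H → x :* (b :+ x :* F) :+ a :* (b :+ a :* A :+ x :* H) := x :* (x :* F :+ a :* H) :+ (x :* b :+ a :* (b :+ a :* A))) refl a b x F A H ⟩
    x * (x * F + a * H) + (x * b + a * (b + a * A))  ≈⟨ +-congʳ (*-congˡ (horner-correct a f x)) ⟩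
    x * (a * A + x * H) + (x * b + a * (b + a * A))
      ≈⟨ solve 6 (λ a b x F A H → x :* (a :* A :+ x :* H) :+ (x :* b :+ a :* (b :+ a :* A)) := a :* (b :+ a :* A) :+ x :* (b :+ a :* A :+ x :* H)) refl a b x F A H ⟩
    a * (b + a * A) + x * (b + a * A + x * H)        ∎
    where
    open ≈-Reasoning setoid
    open RingSolver commutativeSemiring
    F = eval f x
    A = eval f a
    H = eval (horner a f) x

  -- Dividing out the root `a` by Horner's scheme shortens the coefficient list by one, and the
  -- other roots remain roots of the quotient. Counting by list length makes trailing zeros
  -- harmless, and vanishing as a function is enough for the contradiction in `∃nonresidue`.
  many-roots⇒vanishes : ∀ f {xs} → Unique xs → All (λ x → eval f x ≈ 0#) xs →
                        length f ℕ.≤ length xs → ∀ y → eval f y ≈ 0#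
  many-roots⇒vanishes []      _ _ _ y = refl
  many-roots⇒vanishes (b ∷ f) {a ∷ xs} (a∉xs ∷ xs!) (fa≈0 ∷ fxs≈0) (s≤s f≤xs) y = begin
    b + y * eval f y                 ≈⟨ +-congˡ (begin
      y * eval f y                            ≈⟨ +-identityʳ _ ⟨
      y * eval f y + 0#                       ≈⟨ +-congˡ (trans (*-congˡ H≈0) (zeroʳ a)) ⟨
      y * eval f y + a * eval H y             ≈⟨ horner-correct a f y ⟩
      a * eval f a + y * eval H y             ≈⟨ +-congˡ (trans (*-congˡ H≈0) (zeroʳ y)) ⟩
      a * eval f a + 0#                       ≈⟨ +-identityʳ _ ⟩
      a * eval f a                            ∎) ⟩
    b + a * eval f a                 ≈⟨ fa≈0 ⟩
    0#                               ∎
    where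
    open ≈-Reasoning setoid
    H = horner a f

    root : ∀ {x} → ¬ a ≈ x → eval (b ∷ f) x ≈ 0# → eval H x ≈ 0#
    root {x} a≉x fx≈0 = cancel (λ a-x≈0 → a≉x (x∙y⁻¹≈ε⇒x≈y a x a-x≈0))
      (trans ([y-z]x≈yx-zx (eval H x) a x) (x≈y⇒x∙y⁻¹≈ε (+-cancelˡ (x * eval f x) _ _ (begin
        x * eval f x + a * eval H x  ≈⟨ horner-correct a f x ⟩
        a * eval f a + x * eval H x  ≈⟨ +-congʳ (+-cancelˡ b _ _ (trans fa≈0 (sym fx≈0))) ⟩
        x * eval f x + x * eval H x  ∎))))

    H≈0 : eval H y ≈ 0#
    H≈0 = many-roots⇒vanishes H xs! (All.zipWith (λ (a≉x , fx≈0) → root a≉x fx≈0) (a∉xs , fxs≈0))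
      (≡.subst (ℕ._≤ length xs) (≡.sym (length-horner a f)) f≤xs) y

  0<h : 0 ℕ.< h
  0<h with h | q≡1+2h
  ... | suc _ | _      = s≤s z≤n
  ... | zero  | ≡.refl = contradiction (trans (sym (F.strictlyInverseʳ 0#))
    (trans (F.from-cong (Fin1-unique (F.to 0#) (F.to 1#))) (F.strictlyInverseʳ 1#))) 0≉1
    where
    Fin1-unique : ∀ (i j : Fin 1) → i ≡ j
    Fin1-unique Fin.zero Fin.zero = ≡.refl

  legendre≡^h : ∀ a → legendre 𝔽 a ≈ a ^ h
  legendre≡^h a = reflexive (cong (a ^_) (≡.trans (cong (λ k → (k ∸ 1) / 2) q≡1+2h) (double/2 h)))

  -- This is x ^ (k + 1) - 1; for k + 1 = h its roots are the elements of Legendre symbol 1.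
  x^-1 : ℕ → Poly
  x^-1 k = - 1# ∷ replicate k 0# ++ 1# ∷ []

  eval-x^-1 : ∀ k x → eval (x^-1 k) x ≈ - 1# + x ^ suc k
  eval-x^-1 k x = +-congˡ (*-congˡ (go k))
    where
    go : ∀ k → eval (replicate k 0# ++ 1# ∷ []) x ≈ x ^ k
    go zero    = trans (+-congˡ (zeroʳ x)) (+-identityʳ 1#)
    go (suc k) = trans (+-identityˡ _) (*-congˡ (go k))

  legendre-square : ∀ {a} → ¬ a ≈ 0# → legendre 𝔽 a * legendre 𝔽 a ≈ 1#
  legendre-square {a} a≉0 = trans (*-cong (legendre≡^h a) (legendre≡^h a)) (trans (sym (^-homo-* a h h)) (fermat a≉0))

  square≈1⇒±1 : ∀ {x} → x * x ≈ 1# → ¬ x ≈ 1# → x ≈ - 1#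
  square≈1⇒±1 {x} xx≈1 x≉1 = begin
    x                          ≈⟨ x∙y⁻¹≈ε⇒x≈y x (- 1#) (cancel (λ e → x≉1 (x∙y⁻¹≈ε⇒x≈y x 1# e)) (begin
      (x - 1#) * (x - - 1#)                    ≈⟨ *-congˡ (+-congˡ (-‿involutive 1#)) ⟩
      (x - 1#) * (x + 1#)                      ≈⟨ distribˡ (x - 1#) x 1# ⟩
      (x - 1#) * x + (x - 1#) * 1#             ≈⟨ +-cong ([y-z]x≈yx-zx x x 1#) (*-identityʳ _) ⟩
      (x * x - 1# * x) + (x - 1#)              ≈⟨ +-congʳ (+-cong xx≈1 (-‿cong (*-identityˡ x))) ⟩
      (1# - x) + (x - 1#)                      ≈⟨ +-congˡ (⁻¹-anti-homo-// 1# x) ⟨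
      (1# - x) + - (1# - x)                    ≈⟨ -‿inverseʳ _ ⟩
      0#                                       ∎)) ⟩
    - 1#                       ∎
    where
    open ≈-Reasoning setoid

  -- Otherwise x ^ h - 1 would vanish at all 2 h units. With its h + 1 coefficients it would then
  -- vanish everywhere, but its value at 0 is -1.
  ∃nonresidue : ∃ λ g → legendre 𝔽 g ≈ - 1#
  ∃nonresidue with all? (λ x → legendre 𝔽 x ≈? 1#) nonzeros
  ... | no ¬all = find (Allₚ.¬All⇒Any¬ (λ x → legendre 𝔽 x ≈? 1#) nonzeros ¬all) nonzeros≉0
    where
    find : ∀ {xs} → Any.Any (λ x → ¬ legendre 𝔽 x ≈ 1#) xs → All (λ x → ¬ x ≈ 0#) xs → ∃ λ g → legendre 𝔽 g ≈ - 1#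
    find (here {x = x} ≉1) (x≉0 ∷ _) = x , square≈1⇒±1 (legendre-square x≉0) ≉1
    find (there p)         (_ ∷ ps)  = find p ps
  ... | yes all = contradiction (begin
    0#                          ≈⟨ -0#≈0# ⟨
    - 0#
      ≈⟨ -‿cong (many-roots⇒vanishes (x^-1 k) nonzeros! roots length≤ 0#) ⟨
    - eval (x^-1 k) 0#          ≈⟨ -‿cong (trans (+-congˡ (zeroˡ _)) (+-identityʳ _)) ⟩
    - - 1#                      ≈⟨ -‿involutive 1# ⟩
    1#                          ∎) 0≉1
    where
    open ≈-Reasoning setoid
    k = ℕ.pred h
    h≡1+k : h ≡ suc k
    h≡1+k = ≡.sym (ℕₚ.suc-pred h {{ℕ.>-nonZero 0<h}})
    roots : All (λ x → eval (x^-1 k) x ≈ 0#) nonzeros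
    roots = All.map (λ {x} leg≈1 → begin
      eval (x^-1 k) x          ≈⟨ eval-x^-1 k x ⟩
      - 1# + x ^ suc k         ≡⟨ cong (λ n → - 1# + x ^ n) h≡1+k ⟨
      - 1# + x ^ h             ≈⟨ +-congˡ (trans (sym (legendre≡^h x)) leg≈1) ⟩
      - 1# + 1#                ≈⟨ -‿inverseˡ 1# ⟩
      0#                       ∎) all
    -- With h = k + 1 this compares k + 2 coefficients with 2 k + 2 units.
    length≤ : length (x^-1 k) ℕ.≤ length nonzeros
    length≤ = ≡.subst₂ ℕ._≤_
      (≡.sym (cong suc (≡.trans (List.length-++ (replicate k 0#)) (cong₂ ℕ._+_ (List.length-replicate k) ≡.refl))))
      (≡.sym (≡.trans length-nonzeros (cong₂ ℕ._+_ h≡1+k h≡1+k)))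
      (s≤s (ℕₚ.+-monoʳ-≤ k (s≤s z≤n)))

  -- The Legendre symbol as an integer, since sums in the field would only be known modulo the
  -- characteristic. As a relation it lets uniqueness and multiplicativity be proved by cases.
  data Character (a : Carrier) : ℤ → Set ℓ where
    vanishing  : a ≈ 0# → Character a 0ℤ
    residue    : legendre 𝔽 a ≈ 1# → Character a 1ℤ
    nonresidue : legendre 𝔽 a ≈ - 1# → Character a -1ℤ

  legendre-cong : ∀ {a b} → a ≈ b → legendre 𝔽 a ≈ legendre 𝔽 b
  legendre-cong a≈b = ^-congˡ ((q ∸ 1) / 2) a≈b

  legendre-* : ∀ a b → legendre 𝔽 (a * b) ≈ legendre 𝔽 a * legendre 𝔽 b
  legendre-* a b = ^-distrib-* a b ((q ∸ 1) / 2)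

  legendre-zero : ∀ {a} → a ≈ 0# → legendre 𝔽 a ≈ 0#
  legendre-zero {a} a≈0 = trans (legendre≡^h a) (go 0<h)
    where
    go : ∀ {n} → 0 ℕ.< n → a ^ n ≈ 0#
    go (s≤s _) = trans (*-congʳ a≈0) (zeroˡ _)

  -1≉0 : ¬ - 1# ≈ 0#
  -1≉0 -1≈0 = 0≉1 (sym (trans (sym (-‿involutive 1#)) (trans (-‿cong -1≈0) -0#≈0#)))

  -- The field values 0, 1 and -1 of `legendre` are pairwise distinct; for 1 and -1 this is the odd
  -- characteristic.
  character-unique : ∀ {a b x y} → a ≈ b → Character a x → Character b y → x ≡ y
  character-unique a≈b (vanishing _)    (vanishing _)    = ≡.refl
  character-unique a≈b (vanishing a≈0)  (residue b)      =
    contradiction (trans (sym (legendre-zero a≈0)) (trans (legendre-cong a≈b) b)) 0≉1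
  character-unique a≈b (vanishing a≈0)  (nonresidue b)   =
    contradiction (trans (sym (trans (legendre-cong a≈b) b)) (legendre-zero a≈0)) -1≉0
  character-unique a≈b (residue _)      (residue _)      = ≡.refl
  character-unique a≈b (residue a)      (nonresidue b)   =
    contradiction (trans (sym a) (trans (legendre-cong a≈b) b)) 1≉-1
  character-unique a≈b (nonresidue _)   (nonresidue _)   = ≡.refl
  character-unique a≈b p@(residue _)    r@(vanishing _)  = ≡.sym (character-unique (sym a≈b) r p)
  character-unique a≈b p@(nonresidue _) r@(vanishing _)  = ≡.sym (character-unique (sym a≈b) r p)
  character-unique a≈b p@(nonresidue _) r@(residue _)    = ≡.sym (character-unique (sym a≈b) r p)

  character-* : ∀ {a b x y} → Character a x → Character b y → Character (a * b) (x ℤ.* y)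
  character-* {a} {b} (vanishing a≈0) _ = vanishing (trans (*-congʳ a≈0) (zeroˡ b))
  character-* {a} {b} {x} p (vanishing b≈0) =
    ≡.subst (Character (a * b)) (≡.sym (ℤₚ.*-zeroʳ x)) (vanishing (trans (*-congˡ b≈0) (zeroʳ a)))
  character-* {a} {b} (residue p)    (residue r)    = residue (trans (legendre-* a b) (trans (*-cong p r) (*-identityˡ 1#)))
  character-* {a} {b} (residue p)    (nonresidue r) = nonresidue (trans (legendre-* a b) (trans (*-cong p r) (*-identityˡ (- 1#))))
  character-* {a} {b} (nonresidue p) (residue r)    = nonresidue (trans (legendre-* a b) (trans (*-cong p r) (*-identityʳ (- 1#))))
  character-* {a} {b} (nonresidue p) (nonresidue r) = residue (trans (legendre-* a b) (trans (*-cong p r) (trans (-1*x≈-x (- 1#)) (-‿involutive 1#))))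

  character : ∀ a → ∃ (Character a)
  character a with a ≈? 0# | legendre 𝔽 a ≈? 1#
  ... | yes a≈0 | _      = 0ℤ , vanishing a≈0
  ... | no _    | yes p  = 1ℤ , residue p
  ... | no a≉0  | no ≉1  = -1ℤ , nonresidue (square≈1⇒±1 (legendre-square a≉0) ≉1)

  σ : Carrier → ℤ
  σ a = proj₁ (character a)

  character≡ : ∀ {a x} → Character a x → σ a ≡ x
  character≡ {a} p = character-unique refl (proj₂ (character a)) p

  σ-cong : ∀ {a b} → a ≈ b → σ a ≡ σ b
  σ-cong {a} {b} a≈b = character-unique a≈b (proj₂ (character a)) (proj₂ (character b))

  σ-* : ∀ a b → σ (a * b) ≡ σ a ℤ.* σ b
  σ-* a b = character≡ (character-* (proj₂ (character a)) (proj₂ (character b)))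

  σ≡-1⇒legendre : ∀ a → σ a ≡ -1ℤ → legendre 𝔽 a ≈ - 1#
  σ≡-1⇒legendre a e with character a
  σ≡-1⇒legendre a ≡.refl | _ , nonresidue p = p

  legendre⇒σ≡-1 : ∀ {a} → legendre 𝔽 a ≈ - 1# → σ a ≡ -1ℤ
  legendre⇒σ≡-1 p = character≡ (nonresidue p)

  σ≢0 : ∀ {a} → ¬ a ≈ 0# → ¬ σ a ≡ 0ℤ
  σ≢0 {a} a≉0 e with character a
  σ≢0 a≉0 ≡.refl | _ , vanishing a≈0 = a≉0 a≈0

  σ-square : ∀ {a} → ¬ a ≈ 0# → σ (a * a) ≡ 1ℤ
  σ-square {a} a≉0 = character≡ (residue (trans (legendre-* a a) (legendre-square a≉0)))

  σ-1 : σ 1# ≡ 1ℤ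
  σ-1 = ≡.trans (σ-cong (sym (*-identityˡ 1#))) (σ-square (λ 1≈0 → 0≉1 (sym 1≈0)))

  σ-values : ∀ a → σ a ≡ 0ℤ ⊎ σ a ≡ 1ℤ ⊎ σ a ≡ -1ℤ
  σ-values a with character a
  ... | _ , vanishing _  = inj₁ ≡.refl
  ... | _ , residue _    = inj₂ (inj₁ ≡.refl)
  ... | _ , nonresidue _ = inj₂ (inj₂ ≡.refl)

  g : Carrier
  g = proj₁ ∃nonresidue

  σ-g* : ∀ a → σ (g * a) ≡ ℤ.- σ a
  σ-g* a = begin
    σ (g * a)         ≡⟨ σ-* g a ⟩
    σ g ℤ.* σ a       ≡⟨ cong (ℤ._* σ a) (legendre⇒σ≡-1 (proj₂ ∃nonresidue)) ⟩
    -1ℤ ℤ.* σ a       ≡⟨ ℤₚ.-1*i≡-i (σ a) ⟩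
    ℤ.- σ a           ∎
    where open ≡.≡-Reasoning

  g≉0 : ¬ g ≈ 0#
  g≉0 g≈0 = -1≉0 (trans (sym (proj₂ ∃nonresidue)) (legendre-zero g≈0))

  -- Multiplication by the non-residue `g` permutes the field and negates every term.
  Σ-σ : Σ[ σ ] elements ≡ 0ℤ
  Σ-σ = x≡-x⇒x≡0 _ (begin
    Σ[ σ ] elements                    ≡⟨ Σ-↭ σ σ-cong (injective⇒↭ (g *_) (*-cancel g≉0)) ⟨
    Σ[ σ ] (map (g *_) elements)       ≡⟨ Σ-map σ (g *_) elements ⟩
    Σ[ (λ a → σ (g * a)) ] elements
      ≡⟨ Σ-cong elements (All.universal (λ a → ≡.trans (σ-g* a) (≡.sym (ℤₚ.-1*i≡-i (σ a)))) elements) ⟩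
    Σ[ (λ a → -1ℤ ℤ.* σ a) ] elements  ≡⟨ Σ-*ˡ -1ℤ σ elements ⟩
    -1ℤ ℤ.* Σ[ σ ] elements            ≡⟨ ℤₚ.-1*i≡-i _ ⟩
    ℤ.- Σ[ σ ] elements                ∎)
    where open ≡.≡-Reasoning

  -- The inverse, extended by 0 ↦ 0 to a permutation of the field.
  Inverse₀ : Carrier → Carrier → Set ℓ
  Inverse₀ a b = (a ≈ 0# × b ≈ 0#) ⊎ a * b ≈ 1#

  ∃inverse₀ : ∀ a → ∃ (Inverse₀ a)
  ∃inverse₀ a with a ≈? 0#
  ... | yes a≈0 = 0# , inj₁ (a≈0 , refl)
  ... | no a≉0 with b , ab≈1 ← inverse a a≉0 = b , inj₂ ab≈1

  inverse₀ : Carrier → Carrier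
  inverse₀ a = proj₁ (∃inverse₀ a)

  inverse₀-unique : ∀ {a b a′ b′} → Inverse₀ a b → Inverse₀ a′ b′ → a ≈ a′ → b ≈ b′
  inverse₀-unique (inj₁ (_ , b≈0)) (inj₁ (_ , b′≈0)) a≈a′ = trans b≈0 (sym b′≈0)
  inverse₀-unique {b′ = b′} (inj₁ (a≈0 , _)) (inj₂ a′b′≈1) a≈a′ = contradiction
    (trans (sym (zeroˡ b′)) (trans (*-congʳ (trans (sym a≈0) a≈a′)) a′b′≈1)) 0≉1
  inverse₀-unique {b = b} (inj₂ ab≈1) (inj₁ (a′≈0 , _)) a≈a′ = contradiction
    (trans (sym (zeroˡ b)) (trans (*-congʳ (trans (sym a′≈0) (sym a≈a′))) ab≈1)) 0≉1
  inverse₀-unique {a} {b} (inj₂ ab≈1) (inj₂ a′b′≈1) a≈a′ =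
    *-cancel (λ a≈0 → 0≉1 (trans (sym (zeroˡ b)) (trans (*-congʳ (sym a≈0)) ab≈1)))
      (trans ab≈1 (trans (sym a′b′≈1) (*-congʳ (sym a≈a′))))

  inverse₀-sym : ∀ {a b} → Inverse₀ a b → Inverse₀ b a
  inverse₀-sym (inj₁ (a≈0 , b≈0)) = inj₁ (b≈0 , a≈0)
  inverse₀-sym (inj₂ ab≈1)        = inj₂ (trans (*-comm _ _) ab≈1)

  inverse₀-injective : ∀ {a b} → inverse₀ a ≈ inverse₀ b → a ≈ b
  inverse₀-injective {a} {b} = inverse₀-unique (inverse₀-sym (proj₂ (∃inverse₀ a))) (inverse₀-sym (proj₂ (∃inverse₀ b)))

  private
    factor : ∀ {b b⁻¹ w} → b * b⁻¹ ≈ 1# → b * (b + w) ≈ (b * b) * (1# + w * b⁻¹)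
    factor {b} {b⁻¹} {w} bb⁻¹≈1 = begin
      b * (b + w)                      ≈⟨ *-congˡ (+-congˡ (*-identityˡ w)) ⟨
      b * (b + 1# * w)                 ≈⟨ *-congˡ (+-congˡ (*-congʳ bb⁻¹≈1)) ⟨
      b * (b + (b * b⁻¹) * w)
        ≈⟨ solve 3 (λ b w i → b :* (b :+ (b :* i) :* w) := (b :* b) :* (con 1 :+ w :* i)) refl b w b⁻¹ ⟩
      (b * b) * (1# + w * b⁻¹)         ∎
      where
      open ≈-Reasoning setoid
      open RingSolver commutativeSemiring

  -- For b ≠ 0, σ (b (b + w)) = σ (1 + w / b), and 1 + w / b takes all values but 1.
  Σ-σ-shifted : ∀ {w} → ¬ w ≈ 0# → Σ[ (λ b → σ (b * (b + w))) ] elements ≡ -1ℤ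
  Σ-σ-shifted {w} w≉0 = begin
    σ (0# * (0# + w)) ℤ.+ Σ[ ψ ] nonzeros
      ≡⟨ cong₂ ℤ._+_ (character≡ (vanishing (zeroˡ _))) (Σ-cong nonzeros (All.map ψ≡σφ nonzeros≉0)) ⟩
    -- The sum is completed by a term at `0#`. As `inverse₀` fixes zero, `φ` is 1 there, so the new
    -- term is 1 and is compensated by -1.
    0ℤ ℤ.+ Σ[ (λ b → σ (φ b)) ] nonzeros              ≡⟨ lemma (Σ[ (λ b → σ (φ b)) ] nonzeros) ⟩
    -1ℤ ℤ.+ (1ℤ ℤ.+ Σ[ (λ b → σ (φ b)) ] nonzeros)
      ≡⟨ cong (λ x → -1ℤ ℤ.+ (x ℤ.+ Σ[ (λ b → σ (φ b)) ] nonzeros)) σφ0 ⟨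
    -1ℤ ℤ.+ Σ[ (λ b → σ (φ b)) ] elements             ≡⟨ cong (ℤ._+_ -1ℤ) (Σ-map σ φ elements) ⟨
    -1ℤ ℤ.+ Σ[ σ ] (map φ elements)
      ≡⟨ cong (ℤ._+_ -1ℤ) (Σ-↭ σ σ-cong (injective⇒↭ φ λ e → inverse₀-injective (*-cancel w≉0 (+-cancelˡ 1# _ _ e)))) ⟩
    -1ℤ ℤ.+ Σ[ σ ] elements                           ≡⟨ cong (ℤ._+_ -1ℤ) Σ-σ ⟩
    -1ℤ                                               ∎
    where
    open ≡.≡-Reasoning
    ψ : Carrier → ℤ
    ψ b = σ (b * (b + w))
    φ : Carrier → Carrier
    φ b = 1# + w * inverse₀ b
    lemma : ∀ x → 0ℤ ℤ.+ x ≡ -1ℤ ℤ.+ (1ℤ ℤ.+ x)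
    lemma = solve-∀
    σφ0 : σ (φ 0#) ≡ 1ℤ
    σφ0 = ≡.trans (σ-cong (trans (+-congˡ (trans (*-congˡ (inverse₀-unique (proj₂ (∃inverse₀ 0#)) (inj₁ (refl , refl)) refl)) (zeroʳ w))) (+-identityʳ 1#))) σ-1
    ψ≡σφ : ∀ {b} → ¬ b ≈ 0# → ψ b ≡ σ (φ b)
    ψ≡σφ {b} b≉0 with proj₂ (∃inverse₀ b)
    ... | inj₁ (b≈0 , _) = contradiction b≈0 b≉0
    ... | inj₂ bb⁻¹≈1    = begin
      σ (b * (b + w))              ≡⟨ σ-cong (factor bb⁻¹≈1) ⟩
      σ ((b * b) * φ b)            ≡⟨ σ-* (b * b) (φ b) ⟩
      σ (b * b) ℤ.* σ (φ b)        ≡⟨ cong (ℤ._* σ (φ b)) (σ-square b≉0) ⟩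
      1ℤ ℤ.* σ (φ b)               ≡⟨ ℤₚ.*-identityˡ _ ⟩
      σ (φ b)                      ∎

-- Lists of monic polynomials and the sieve of Eratosthenes

module MonicPolynomials {q c ℓ} (𝔽 : FiniteField q c ℓ) (2∤q : 2 ∤ q) where

  open FiniteField 𝔽
  open Polynomial commutativeRing
  open PolynomialRing commutativeRing
  open Degree commutativeRing
  open FiniteFieldPolynomials 𝔽
  open QuadraticCharacter 𝔽 2∤q using (elements; elements!; ∈-elements)
  open Membership polySetoid using (_∈_)
  open Unique polySetoid using (Unique)

  monics : ℕ → List Poly
  monics zero    = (1# ∷ []) ∷ []
  monics (suc n) = cartesianProductWith _∷_ elements (monics n)

  mutual
    monics-monic : ∀ n → All (MonicOfDegree n) (monics n)
    monics-monic zero    = one-monic ∷ []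
    monics-monic (suc n) = Allₚ.cartesianProductWith⁺ setoid polySetoid _∷_ elements (monics n)
      λ {_} {f} _ f∈ → let top , f<n = ∈-monics⁻ n {f} f∈ in top , λ { (suc i) (s≤s n<i) → f<n i n<i }

    ∈-monics⁻ : ∀ n {f} → f ∈ monics n → MonicOfDegree n f
    ∈-monics⁻ n {f} f∈ = All.lookupWith (λ {g} g-monic f≈g → monic-resp {f = g} {f} (λ i → sym (f≈g i)) g-monic)
      (monics-monic n) f∈

  ∈-monics : ∀ {n} f → MonicOfDegree n f → f ∈ monics n
  ∈-monics {zero}  f       f-monic     = here (monic-0 {f} f-monic)
  ∈-monics {suc n} []      (top , _)   = contradiction top 0≉1
  ∈-monics {suc n} (a ∷ f) (top , f<n) =
    Membershipₚ.∈-cartesianProductWith⁺ setoid polySetoid polySetoid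
      (λ {a} {b} {f} {g} → ∷-cong {a} {b} {f} {g}) {xs = elements} (∈-elements a)
      (∈-monics {n} f (top , λ i n<i → f<n (suc i) (s≤s n<i)))

  monics! : ∀ n → Unique (monics n)
  monics! zero    = [] ∷ []
  monics! (suc n) = Uniqueₚ.cartesianProductWith⁺ setoid polySetoid polySetoid _∷_
    (λ e → e 0 , λ i → e (suc i)) elements! (monics! n)

  infix 4 _∣?_
  -- Scaling by a unit does not affect divisibility, so a nonzero `P` may be made monic; the zero
  -- polynomial divides only itself.
  _∣?_ : Decidable _∣ₚ_
  P ∣? f with degree-view P
  ... | inj₁ P≈0 = map′
    (λ f≈0 → [] , λ i → trans (*ₚ-zeroʳ P i) (sym (f≈0 i)))
    (λ (h , Ph≈f) i → trans (sym (Ph≈f i)) (*ₚ-zeroˡ {P} h P≈0 i))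
    (f ≈[]?)
  ... | inj₂ (n , top≉0 , P<n) with a , ta≈1 ← inverse (coeff P n) top≉0 = map′
    (λ (h , aPh≈f) → a ·ₚ h , λ i → trans (swap a h i) (aPh≈f i))
    (λ (h , Ph≈f) → coeff P n ·ₚ h , λ i → (begin
      coeff ((a ·ₚ P) *ₚ (t ·ₚ h)) i    ≈⟨ swap a (t ·ₚ h) i ⟨
      coeff (P *ₚ (a ·ₚ t ·ₚ h)) i      ≈⟨ *ₚ-congˡ P {a ·ₚ t ·ₚ h} {h} (λ j → trans (·-assoc a t h j)
                                             (trans (·-cong {a * t} {1#} {h} {h} (trans (*-comm a t) ta≈1) (λ _ → refl) j) (·-identityˡ h j))) i ⟩
      coeff (P *ₚ h) i                  ≈⟨ Ph≈f i ⟩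
      coeff f i                         ∎))
    (monic-∣? (a ·ₚ P) (·-monic a P (trans (*-comm a t) ta≈1) P<n) f)
    where
    open ≈-Reasoning setoid
    t = coeff P n
    swap : ∀ a h → P *ₚ (a ·ₚ h) ≈ₚ (a ·ₚ P) *ₚ h
    swap a h i = trans (*ₚ-comm P (a ·ₚ h) i) (trans (·-*ₚ-assoc a h P i)
      (trans (·-cong {a} {a} {h *ₚ P} {P *ₚ h} refl (*ₚ-comm h P) i) (sym (·-*ₚ-assoc a P h i))))

  Rough : List Poly → Poly → Set _
  Rough Ps f = All (λ P → ¬ P ∣ₚ f) Ps

  rough? : ∀ Ps → Decidable₁ (Rough Ps)
  rough? Ps f = all? (λ P → ¬? (P ∣? f)) Ps

  rough-divisor : ∀ {Ps f g} → f ∣ₚ g → Rough Ps g → Rough Ps f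
  rough-divisor {f = f} {g} (k , fk≈g) = All.map λ {P} P∤g P∣f →
    P∤g (∣ₚ-respʳ {P} {f *ₚ k} {g} fk≈g (∣ₚ-*ʳ {P} {f} k P∣f))

  rough-resp : ∀ {Ps f g} → f ≈ₚ g → Rough Ps f → Rough Ps g
  rough-resp {f = f} {g} f≈g = All.map λ {P} P∤f P∣g → P∤f (∣ₚ-respʳ {P} {g} {f} (λ i → sym (f≈g i)) P∣g)

  -- The sieve of Eratosthenes: irreducibles m lists the irreducible monics of degree suc m.
  mutual
    irreducibles : ℕ → List Poly
    irreducibles m = filter (rough? (irreducibles≤ m)) (monics (suc m))

    irreducibles≤ : ℕ → List Poly
    irreducibles≤ zero    = []
    irreducibles≤ (suc m) = irreducibles m ++ irreducibles≤ m

  irreducibles! : ∀ m → Unique (irreducibles m)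
  irreducibles! m = Uniqueₚ.filter⁺ polySetoid (rough? (irreducibles≤ m)) (monics! (suc m))

  irreducibles-monic : ∀ m → All (MonicOfDegree (suc m)) (irreducibles m)
  irreducibles-monic m = Allₚ.filter⁺ (rough? (irreducibles≤ m)) (monics-monic (suc m))

  irreducibles-rough : ∀ m → All (Rough (irreducibles≤ m)) (irreducibles m)
  irreducibles-rough m = Allₚ.all-filter (rough? (irreducibles≤ m)) (monics (suc m))

  ∈-irreducibles : ∀ {m} f → MonicOfDegree (suc m) f → Rough (irreducibles≤ m) f → f ∈ irreducibles m
  ∈-irreducibles {m} f f-monic f-rough = Membershipₚ.∈-filter⁺ polySetoid (rough? (irreducibles≤ m))
    (λ {f} {g} → rough-resp {f = f} {g}) {v = f} (∈-monics f f-monic) f-rough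

  -- If no listed polynomial of degree below n divides `f`, then the sieve has put `f` itself on the
  -- list, and `f` divides `f`.
  monic-small⇒¬rough : ∀ m {n} f → MonicOfDegree n f → 1 ℕ.≤ n → n ℕ.≤ m → ¬ Rough (irreducibles≤ m) f
  monic-small⇒¬rough zero f f-monic 1≤n n≤0 _ = contradiction (ℕₚ.≤-trans 1≤n n≤0) λ ()
  monic-small⇒¬rough (suc m) {n} f f-monic 1≤n n≤1+m f-rough with ℕₚ.m≤n⇒m<n∨m≡n n≤1+m
  ... | inj₁ (s≤s n≤m) = monic-small⇒¬rough m f f-monic 1≤n n≤m (Allₚ.++⁻ʳ (irreducibles m) f-rough)
  ... | inj₂ ≡.refl = All.lookupWith (λ {P} P∤f f≈P → P∤f (1# ∷ [] , λ i →
            trans (*ₚ-comm P (1# ∷ []) i) (trans (*ₚ-identityˡ P i) (sym (f≈P i)))))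
          (Allₚ.++⁻ˡ (irreducibles m) f-rough)
          (∈-irreducibles f f-monic (Allₚ.++⁻ʳ (irreducibles m) f-rough))

  -- In a proper monic factorisation the first factor has degree between 1 and m, and as a divisor
  -- of `P` it would again be rough.
  rough⇒unsplittable : ∀ {m} P → MonicOfDegree (suc m) P → Rough (irreducibles≤ m) P → Unsplittable P
  rough⇒unsplittable {m} P P-monic P-rough {zero}  {b}     f g f-monic g-monic fg≈P = inj₁ ≡.refl
  rough⇒unsplittable {m} P P-monic P-rough {suc a} {zero}  f g f-monic g-monic fg≈P = inj₂ ≡.refl
  rough⇒unsplittable {m} P P-monic P-rough {suc a} {suc b} f g f-monic g-monic fg≈P =
    contradiction (rough-divisor {f = f} {P} (g , fg≈P) P-rough)
      (monic-small⇒¬rough m f f-monic (s≤s z≤n) (ℕₚ.m+n≤o⇒m≤o (suc a) (ℕₚ.≤-reflexive (ℕₚ.suc-injective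
        (≡.trans (≡.sym (ℕₚ.+-suc (suc a) b)) (monic-degree-unique {f = P} (monic-resp {f = f *ₚ g} {P} fg≈P (monic-* f g f-monic g-monic)) P-monic))))))

  MonicIrreducible : Pred Poly _
  MonicIrreducible P = ∃ λ d → MonicOfDegree d P × Unsplittable P

  irreducibles-unsplittable : ∀ m → All Unsplittable (irreducibles m)
  irreducibles-unsplittable m = All.zipWith (λ {P} (P-monic , P-rough) {a} {b} → rough⇒unsplittable {m} P P-monic P-rough {a} {b})
    (irreducibles-monic m , irreducibles-rough m)

  irreducibles≤-degree : ∀ m → All (λ P → ∃ λ d → 1 ℕ.≤ d × d ℕ.≤ m × MonicOfDegree d P × Unsplittable P) (irreducibles≤ m)
  irreducibles≤-degree zero    = []
  irreducibles≤-degree (suc m) = Allₚ.++⁺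
    (All.zipWith (λ {P} (P-monic , P-unsplit) → suc m , s≤s z≤n , ℕₚ.≤-refl , P-monic , λ {a} {b} → P-unsplit {a} {b})
      (irreducibles-monic m , irreducibles-unsplittable m))
    (All.map (λ { (d , 1≤d , d≤m , rest) → d , 1≤d , ℕₚ.m≤n⇒m≤1+n d≤m , rest }) (irreducibles≤-degree m))

  unit⇒degree-0 : ∀ {n} f → MonicOfDegree n f → f ∣ₚ 1# ∷ [] → n ≡ 0
  unit⇒degree-0 {n} f f-monic (h , fh≈1) with e , n+e≡0 , _ ← monic-cofactor f h (1# ∷ []) f-monic one-monic fh≈1 =
    ℕₚ.m+n≡0⇒m≡0 n n+e≡0

  open import Algebra.Definitions.RawMagma (CommutativeRing.*-rawMagma polyCommutativeRing) using (_,_) renaming (_∣_ to _∣ᴿ_)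

  ∣⇒∣ₚ : ∀ {f g} → f ∣ᴿ g → f ∣ₚ g
  ∣⇒∣ₚ {f} {g} (h , hf≈g) = h , λ i → trans (*ₚ-comm f h i) (hf≈g i)

  ∣ₚ⇒∣ : ∀ {f g} → f ∣ₚ g → f ∣ᴿ g
  ∣ₚ⇒∣ {f} {g} (h , fh≈g) = h , λ i → trans (*ₚ-comm h f i) (fh≈g i)

  -- A listed divisor has degree between 1 and m, so both it and its cofactor have positive degree
  -- and neither is a unit.
  irreducible⇒rough : ∀ {m} f → MonicOfDegree (suc m) f → Irreducible f → Rough (irreducibles≤ m) f
  irreducible⇒rough {m} f f-monic f-irr = All.map
    (λ { {P} (d , 1≤d , d≤m , P-monic , _) (h , Ph≈f) → split P h 1≤d d≤m P-monic Ph≈f }) (irreducibles≤-degree m)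
    where
    split : ∀ {d} P h → 1 ℕ.≤ d → d ℕ.≤ m → MonicOfDegree d P → ¬ P *ₚ h ≈ₚ f
    split {d} P h 1≤d d≤m P-monic Ph≈f
      with e , d+e≡1+m , h-monic ← monic-cofactor P h f P-monic f-monic Ph≈f
      with Irreducible.split-∣1 f-irr {P} {h} (λ i → sym (Ph≈f i))
    ... | inj₁ P∣1 = contradiction 1≤d (ℕₚ.<⇒≱ (s≤s (ℕₚ.≤-reflexive (unit⇒degree-0 P P-monic (∣⇒∣ₚ {P} P∣1)))))
    ... | inj₂ h∣1 = contradiction d≤m (ℕₚ.<⇒≱ (ℕₚ.≤-reflexive (≡.sym (≡.trans (≡.sym (ℕₚ.+-identityʳ d))
            (≡.trans (cong (d ℕ.+_) (≡.sym (unit⇒degree-0 h h-monic (∣⇒∣ₚ {h} h∣1)))) d+e≡1+m)))))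

  -- If P = x y is monic with leading coefficients a and b of the factors, then a b = 1,
  -- so b x and a y are monic with product P.
  unsplittable⇒irreducible : ∀ {m} P → MonicOfDegree (suc m) P → Unsplittable P → Irreducible P
  unsplittable⇒irreducible {m} P P-monic P-unsplit = record
    { p∤1      = λ P∣1 → ℕₚ.1+n≢0 (unit⇒degree-0 P P-monic (∣⇒∣ₚ {P} P∣1))
    ; split-∣1 = λ {x} {y} P≈xy → split x y P≈xy (degree-view x) (degree-view y)
    }
    where
    P≉0 : ¬ P ≈ₚ []
    P≉0 P≈0 = 0≉1 (trans (sym (P≈0 (suc m))) (proj₁ P-monic))

    unit : ∀ x b → MonicOfDegree 0 (b ·ₚ x) → x ∣ᴿ (1# ∷ [])
    unit x b bx-monic = ∣ₚ⇒∣ {x} (b ∷ [] , λ i → trans (*ₚ-comm x (b ∷ []) i)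
      (trans (+ₚ-cong {b ·ₚ x} {b ·ₚ x} {x· []} {[]} (λ _ → refl) (∷-≈[] refl (λ _ → refl)) i)
        (trans (+ₚ-identityʳ (b ·ₚ x) i) (monic-0 {b ·ₚ x} bx-monic i))))

    split : ∀ x y → P ≈ₚ x *ₚ y → x ≈ₚ [] ⊎ (∃ λ n → HasDegree n x) → y ≈ₚ [] ⊎ (∃ λ n → HasDegree n y) →
            x ∣ᴿ (1# ∷ []) ⊎ y ∣ᴿ (1# ∷ [])
    split x y P≈xy (inj₁ x≈0) _ = contradiction (λ i → trans (P≈xy i) (*ₚ-zeroˡ {x} y x≈0 i)) P≉0
    split x y P≈xy (inj₂ _) (inj₁ y≈0) = contradiction
      (λ i → trans (P≈xy i) (trans (*ₚ-congˡ x {y} {[]} y≈0 i) (*ₚ-zeroʳ x i))) P≉0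
    split x y P≈xy (inj₂ (k , x-k)) (inj₂ (l , y-l)) = conclude (P-unsplit (b ·ₚ x) (a ·ₚ y) bx-monic ay-monic bxay≈P)
      where
      open ≈-Reasoning setoid
      a = coeff x k
      b = coeff y l
      k+l≡1+m : k ℕ.+ l ≡ suc m
      k+l≡1+m = degree-unique {f = P} (degree-resp {f = x *ₚ y} {P} (λ i → sym (P≈xy i)) (degree-* x y x-k y-l)) (monic⇒degree {f = P} P-monic)
      ab≈1 : a * b ≈ 1#
      ab≈1 = begin
        a * b                        ≈⟨ coeff-top-* {k} {l} x y (proj₂ x-k) (proj₂ y-l) ⟨
        coeff (x *ₚ y) (k ℕ.+ l)     ≈⟨ P≈xy (k ℕ.+ l) ⟨
        coeff P (k ℕ.+ l)            ≡⟨ cong (coeff P) k+l≡1+m ⟩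
        coeff P (suc m)              ≈⟨ proj₁ P-monic ⟩
        1#                           ∎
      bx-monic : MonicOfDegree k (b ·ₚ x)
      bx-monic = ·-monic b x (trans (*-comm b a) ab≈1) (proj₂ x-k)
      ay-monic : MonicOfDegree l (a ·ₚ y)
      ay-monic = ·-monic a y ab≈1 (proj₂ y-l)
      bxay≈P : (b ·ₚ x) *ₚ (a ·ₚ y) ≈ₚ P
      bxay≈P i = begin
        coeff ((b ·ₚ x) *ₚ (a ·ₚ y)) i     ≈⟨ ·-*ₚ-assoc b x (a ·ₚ y) i ⟩
        coeff (b ·ₚ (x *ₚ (a ·ₚ y))) i     ≈⟨ ·-cong {b} {b} {x *ₚ (a ·ₚ y)} {a ·ₚ (x *ₚ y)} refl (λ j → trans (*ₚ-comm x (a ·ₚ y) j)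
                                                (trans (·-*ₚ-assoc a y x j) (·-cong {a} {a} {y *ₚ x} {x *ₚ y} refl (*ₚ-comm y x) j))) i ⟩
        coeff (b ·ₚ a ·ₚ (x *ₚ y)) i       ≈⟨ ·-assoc b a (x *ₚ y) i ⟩
        coeff ((b * a) ·ₚ (x *ₚ y)) i
          ≈⟨ ·-cong {b * a} {1#} {x *ₚ y} {P} (trans (*-comm b a) ab≈1) (λ j → sym (P≈xy j)) i ⟩
        coeff (1# ·ₚ P) i                  ≈⟨ ·-identityˡ P i ⟩
        coeff P i                          ∎
      conclude : k ≡ 0 ⊎ l ≡ 0 → x ∣ᴿ (1# ∷ []) ⊎ y ∣ᴿ (1# ∷ [])
      conclude (inj₁ k≡0) = inj₁ (unit x b (≡.subst (λ n → MonicOfDegree n (b ·ₚ x)) k≡0 bx-monic))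
      conclude (inj₂ l≡0) = inj₂ (unit y a (≡.subst (λ n → MonicOfDegree n (a ·ₚ y)) l≡0 ay-monic))

-- Character sums under the sieve: one Euler factor for each irreducible

Σ-partition : ∀ {a p r s} {A : Set a} {P : Pred A p} {R : Pred A r} {S : Pred A s} (w : A → ℤ)
              (P? : Decidable₁ P) (R? : Decidable₁ R) (S? : Decidable₁ S) →
              (∀ {x} → P x → R x ⊎ S x) → (∀ {x} → R x → P x × ¬ S x) → (∀ {x} → S x → P x) →
              ∀ xs → Σ[ w ] (filter P? xs) ≡ Σ[ w ] (filter R? xs) ℤ.+ Σ[ w ] (filter S? xs)
Σ-partition w P? R? S? P⇒R⊎S R⇒P¬S S⇒P [] = ≡.refl
Σ-partition w P? R? S? P⇒R⊎S R⇒P¬S S⇒P (x ∷ xs)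
  with P? x | R? x | S? x | Σ-partition w P? R? S? P⇒R⊎S R⇒P¬S S⇒P xs
... | yes _ | yes r | yes s | _  = contradiction s (proj₂ (R⇒P¬S r))
... | yes _ | yes _ | no _  | ih = ≡.trans (cong (ℤ._+_ (w x)) ih) (≡.sym (ℤₚ.+-assoc (w x) _ _))
... | yes _ | no _  | yes _ | ih = ≡.trans (cong (ℤ._+_ (w x)) ih) (lemma (w x) (Σ[ w ] (filter R? xs)) (Σ[ w ] (filter S? xs)))
  where
  lemma : ∀ a b c → a ℤ.+ (b ℤ.+ c) ≡ b ℤ.+ (a ℤ.+ c)
  lemma = solve-∀
... | yes p | no ¬r | no ¬s | _  with P⇒R⊎S p
...   | inj₁ r = contradiction r ¬r
...   | inj₂ s = contradiction s ¬s
Σ-partition w P? R? S? P⇒R⊎S R⇒P¬S S⇒P (x ∷ xs)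
    | no ¬p | yes r | _     | _  = contradiction (proj₁ (R⇒P¬S r)) ¬p
Σ-partition w P? R? S? P⇒R⊎S R⇒P¬S S⇒P (x ∷ xs)
    | no ¬p | no _  | yes s | _  = contradiction (S⇒P s) ¬p
Σ-partition w P? R? S? P⇒R⊎S R⇒P¬S S⇒P (x ∷ xs)
    | no _  | no _  | no _  | ih = ih

Σ-cartesianProductWith-[-] : ∀ {a b c} {A : Set a} {B : Set b} {C : Set c} (w : C → ℤ) (f : A → B → C) xs y →
                             Σ[ w ] (cartesianProductWith f xs (y ∷ [])) ≡ Σ[ (λ x → w (f x y)) ] xs
Σ-cartesianProductWith-[-] w f []       y = ≡.refl
Σ-cartesianProductWith-[-] w f (x ∷ xs) y = cong (ℤ._+_ (w (f x y))) (Σ-cartesianProductWith-[-] w f xs y)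

module Sieve {q c ℓ} (𝔽 : FiniteField q c ℓ) (2∤q : 2 ∤ q) (u v : FiniteField.Carrier 𝔽) where

  open FiniteField 𝔽
  open Polynomial commutativeRing
  open PolynomialRing commutativeRing
  open Degree commutativeRing
  open FiniteFieldPolynomials 𝔽
  open QuadraticCharacter 𝔽 2∤q
  open MonicPolynomials 𝔽 2∤q
  open Membership polySetoid using (_∈_)
  open Unique polySetoid using (Unique)
  open Permutation polySetoid using (_↭_)
  open UniqueLists polySetoid using (Σ-↭; unique-⊆-⊇⇒↭; unique-⊆∧length⇒↭; enumeration-cardinality)

  χ : Poly → ℤ
  χ f = σ (eval f u * eval f v)

  χ-cong : ∀ {f g} → f ≈ₚ g → χ f ≡ χ g
  χ-cong {f} {g} f≈g = σ-cong (*-cong (eval-cong {f} {g} u f≈g) (eval-cong {f} {g} v f≈g))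

  χ-* : ∀ f g → χ (f *ₚ g) ≡ χ f ℤ.* χ g
  χ-* f g = ≡.trans (σ-cong (begin
    eval (f *ₚ g) u * eval (f *ₚ g) v              ≈⟨ *-cong (eval-* f g u) (eval-* f g v) ⟩
    (eval f u * eval g u) * (eval f v * eval g v)
      ≈⟨ solve 4 (λ a b c d → (a :* b) :* (c :* d) := (a :* c) :* (b :* d)) refl (eval f u) (eval g u) (eval f v) (eval g v) ⟩
    (eval f u * eval f v) * (eval g u * eval g v)  ∎))
    (σ-* (eval f u * eval f v) (eval g u * eval g v))
    where
    open ≈-Reasoning setoid
    open RingSolver commutativeSemiring

  roughSum : List Poly → Sequence
  roughSum Ps n = Σ[ χ ] (filter (rough? Ps) (monics n))

  module _ {d} (P : Poly) (P-monic : MonicOfDegree d P) (Ps : List Poly)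
           (Ps-irr : All MonicIrreducible Ps) (P-rough : Rough Ps P) where

    private
      multiple? : Decidable₁ (λ f → P ∣ₚ f × Rough Ps f)
      multiple? f = (P ∣? f) ×-dec rough? Ps f

      -- By Euclid's lemma an irreducible of `Ps` dividing P g divides `P` or `g`, and both are
      -- ruled out.
      *-rough : ∀ {g} → Rough Ps g → Rough Ps (P *ₚ g)
      *-rough {g} g-rough = All.zipWith
        (λ {Q} ((Q∤P , Q∤g) , (e , Q-monic , Q-unsplit)) Q∣Pg → case-euclid {Q} Q∤P Q∤g
          (euclid Q P g Q-monic (λ {a} {b} → Q-unsplit {a} {b}) Q∣Pg))
        (All.zip (P-rough , g-rough) , Ps-irr)
        where
        case-euclid : ∀ {Q} → ¬ Q ∣ₚ P → ¬ Q ∣ₚ g → ¬ (Q ∣ₚ P ⊎ Q ∣ₚ g)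
        case-euclid Q∤P Q∤g (inj₁ Q∣P) = Q∤P Q∣P
        case-euclid Q∤P Q∤g (inj₂ Q∣g) = Q∤g Q∣g

      -- Multiplication by the monic `P` is injective by cancellation. It preserves roughness by
      -- `*-rough`, and it reaches every rough multiple because the cofactor is monic of degree `e`
      -- and, being a divisor, rough.
      multiples-↭ : ∀ e → map (P *ₚ_) (filter (rough? Ps) (monics e)) ↭ filter multiple? (monics (d ℕ.+ e))
      multiples-↭ e = unique-⊆-⊇⇒↭
        (Uniqueₚ.map⁺ polySetoid polySetoid (λ {f} {g} → monic-cancelˡ P f g P-monic)
          (Uniqueₚ.filter⁺ polySetoid (rough? Ps) (monics! e)))
        (Uniqueₚ.filter⁺ polySetoid multiple? (monics! (d ℕ.+ e)))
        (Allₚ.map⁺ (All.zipWith (λ {g} (g-monic , g-rough) →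
            Membershipₚ.∈-filter⁺ polySetoid multiple? (λ {f} {g} → multiple-resp {f} {g}) {v = P *ₚ g}
              (∈-monics (P *ₚ g) (monic-* P g P-monic g-monic))
              ((g , λ _ → refl) , *-rough {g} g-rough))
          (Allₚ.filter⁺ (rough? Ps) (monics-monic e) , Allₚ.all-filter (rough? Ps) (monics e))))
        (All.zipWith (λ {f} (f-monic , ((h , Ph≈f) , f-rough)) →
            Membershipₚ.∈-resp-≈ polySetoid {x = P *ₚ h} {f} Ph≈f
              (Membershipₚ.∈-map⁺ polySetoid polySetoid (λ {f} {g} → *ₚ-congˡ P {f} {g}) {v = h}
                (Membershipₚ.∈-filter⁺ polySetoid (rough? Ps) (λ {f} {g} → rough-resp {f = f} {g}) {v = h}
                  (cofactor∈monics h f f-monic Ph≈f)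
                  (rough-divisor {f = h} {f} (P , λ i → trans (*ₚ-comm h P i) (Ph≈f i)) f-rough))))
          (Allₚ.filter⁺ multiple? (monics-monic (d ℕ.+ e)) , Allₚ.all-filter multiple? (monics (d ℕ.+ e))))
        where
        multiple-resp : ∀ {f g} → f ≈ₚ g → P ∣ₚ f × Rough Ps f → P ∣ₚ g × Rough Ps g
        multiple-resp {f} {g} f≈g (P∣f , f-rough) = ∣ₚ-respʳ {P} {f} {g} f≈g P∣f , rough-resp {f = f} {g} f≈g f-rough

        cofactor∈monics : ∀ h f → MonicOfDegree (d ℕ.+ e) f → P *ₚ h ≈ₚ f → h ∈ monics e
        cofactor∈monics h f f-monic Ph≈f with e′ , d+e′≡d+e , h-monic ← monic-cofactor P h f P-monic f-monic Ph≈f =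
          ∈-monics h (≡.subst (λ k → MonicOfDegree k h) (ℕₚ.+-cancelˡ-≡ d e′ e d+e′≡d+e) h-monic)

      multipleSum : ∀ n → Σ[ χ ] (filter multiple? (monics n)) ≡ χ P ℤ.* shift d (roughSum Ps) n
      multipleSum n with n ℕₚ.<? d
      ... | yes n<d = begin
        Σ[ χ ] (filter multiple? (monics n))
          ≡⟨ cong Σ[ χ ] (List.filter-none multiple? (All.map (λ {f} f-monic ((h , Ph≈f) , _) → too-big f h f-monic Ph≈f) (monics-monic n))) ⟩
        0ℤ                                    ≡⟨ ℤₚ.*-zeroʳ (χ P) ⟨
        χ P ℤ.* 0ℤ                            ≡⟨ cong (ℤ._*_ (χ P)) (shift-< (roughSum Ps) n<d) ⟨
        χ P ℤ.* shift d (roughSum Ps) n       ∎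
        where
        open ≡.≡-Reasoning
        too-big : ∀ f h → MonicOfDegree n f → ¬ P *ₚ h ≈ₚ f
        too-big f h f-monic Ph≈f with e , d+e≡n , _ ← monic-cofactor P h f P-monic f-monic Ph≈f =
          ℕₚ.<⇒≱ n<d (ℕₚ.m+n≤o⇒m≤o d (ℕₚ.≤-reflexive d+e≡n))
      ... | no n≮d with e , ≡.refl ← ℕₚ.m≤n⇒∃[o]m+o≡n (ℕₚ.≮⇒≥ n≮d) = begin
        Σ[ χ ] (filter multiple? (monics (d ℕ.+ e)))
          ≡⟨ Σ-↭ χ (λ {f} {g} → χ-cong {f} {g}) (multiples-↭ e) ⟨
        Σ[ χ ] (map (P *ₚ_) roughs)                     ≡⟨ Σ-map χ (P *ₚ_) roughs ⟩
        Σ[ (λ g → χ (P *ₚ g)) ] roughs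
          ≡⟨ Σ-cong roughs (All.universal (χ-* P) roughs) ⟩
        Σ[ (λ g → χ P ℤ.* χ g) ] roughs                 ≡⟨ Σ-*ˡ (χ P) χ roughs ⟩
        χ P ℤ.* roughSum Ps e
          ≡⟨ cong (ℤ._*_ (χ P)) (shift-+ d (roughSum Ps) e) ⟨
        χ P ℤ.* shift d (roughSum Ps) (d ℕ.+ e)         ∎
        where
        open ≡.≡-Reasoning
        roughs = filter (rough? Ps) (monics e)

    -- Adding `P` to the sieve removes precisely the rough multiples of `P`. By multiplicativity of
    -- χ these make up χ(P) T ^ d times the old series.
    roughSum-∷ : roughSum (P ∷ Ps) ≗ Δ (χ P) d (roughSum Ps)
    roughSum-∷ n = begin
      roughSum (P ∷ Ps) n
        ≡⟨ lemma (roughSum (P ∷ Ps) n) multiples ⟩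
      (roughSum (P ∷ Ps) n ℤ.+ multiples) ℤ.- multiples
        ≡⟨ cong₂ ℤ._-_ (≡.sym partition) (multipleSum n) ⟩
      roughSum Ps n ℤ.- χ P ℤ.* shift d (roughSum Ps) n ∎
      where
      open ≡.≡-Reasoning
      multiples = Σ[ χ ] (filter multiple? (monics n))
      lemma : ∀ a b → a ≡ (a ℤ.+ b) ℤ.- b
      lemma = solve-∀
      partition : roughSum Ps n ≡ roughSum (P ∷ Ps) n ℤ.+ multiples
      partition = Σ-partition χ (rough? Ps) (rough? (P ∷ Ps)) multiple?
        (λ {f} f-rough → split f f-rough (P ∣? f))
        (λ { (P∤f ∷ f-rough) → f-rough , λ (P∣f , _) → P∤f P∣f })
        proj₂ (monics n)
        where
        split : ∀ f → Rough Ps f → Dec (P ∣ₚ f) → Rough (P ∷ Ps) f ⊎ (P ∣ₚ f × Rough Ps f)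
        split f f-rough (yes P∣f) = inj₂ (P∣f , f-rough)
        split f f-rough (no P∤f)  = inj₁ (P∤f ∷ f-rough)

  with-value : ℤ → List Poly → List Poly
  with-value x = filter (λ f → χ f ℤₚ.≟ x)

  module _ (m : ℕ) where

    private
      d = suc m

    -- The irreducibles of one degree enter one at a time. Each is rough for those already present:
    -- distinct monics of equal degree do not divide one another, and the smaller irreducibles are
    -- excluded by hypothesis. The commuting factors are collected by the value of χ, where χ = 0
    -- gives the factor 1.
    roughSum-++ : ∀ Qs → Unique Qs → All (MonicOfDegree d) Qs → All Unsplittable Qs → All (Rough (irreducibles≤ m)) Qs →
                  roughSum (Qs ++ irreducibles≤ m) ≗
                  Δ^ 1ℤ d (length (with-value 1ℤ Qs)) (Δ^ -1ℤ d (length (with-value -1ℤ Qs)) (roughSum (irreducibles≤ m)))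
    roughSum-++ [] _ _ _ _ n = ≡.refl
    roughSum-++ (Q ∷ Qs) (Q∉Qs ∷ Qs!) (Q-monic ∷ Qs-monic) (Q-unsplit ∷ Qs-unsplit) (Q-rough ∷ Qs-rough) n = ≡.trans
      (roughSum-∷ Q Q-monic (Qs ++ irreducibles≤ m)
        (Allₚ.++⁺ (All.zipWith (λ {P} (P-monic , P-unsplit) → d , P-monic , λ {a} {b} → P-unsplit {a} {b}) (Qs-monic , Qs-unsplit))
                  (All.map (λ (e , _ , _ , P-irr) → e , P-irr) (irreducibles≤-degree m)))
        (Allₚ.++⁺ (All.zipWith (λ {P} (P-monic , Q≉P) → same-degree P P-monic Q≉P) (Qs-monic , Q∉Qs)) Q-rough) n)
      (≡.trans (Δ-cong (χ Q) d (roughSum-++ Qs Qs! Qs-monic Qs-unsplit Qs-rough) n)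
        (absorb (σ-values (eval Q u * eval Q v))))
      where
      same-degree : ∀ P → MonicOfDegree d P → ¬ Q ≈ₚ P → ¬ P ∣ₚ Q
      same-degree P P-monic Q≉P (h , Ph≈Q) with e , d+e≡d , h-monic ← monic-cofactor P h Q P-monic Q-monic Ph≈Q =
        Q≉P λ i → sym (trans (sym (trans (*ₚ-congˡ P {h} {1# ∷ []} h≈1 i) (trans (*ₚ-comm P (1# ∷ []) i) (*ₚ-identityˡ P i)))) (Ph≈Q i))
        where
        h≈1 : h ≈ₚ 1# ∷ []
        h≈1 = monic-0 {h} (≡.subst (λ k → MonicOfDegree k h) (ℕₚ.+-cancelˡ-≡ d e 0 (≡.trans d+e≡d (≡.sym (ℕₚ.+-identityʳ d)))) h-monic)

      s = roughSum (irreducibles≤ m)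
      k = length (with-value 1ℤ Qs)
      l = length (with-value -1ℤ Qs)

      absorb : χ Q ≡ 0ℤ ⊎ χ Q ≡ 1ℤ ⊎ χ Q ≡ -1ℤ →
               Δ (χ Q) d (Δ^ 1ℤ d k (Δ^ -1ℤ d l s)) n ≡
               Δ^ 1ℤ d (length (with-value 1ℤ (Q ∷ Qs))) (Δ^ -1ℤ d (length (with-value -1ℤ (Q ∷ Qs))) s) n
      absorb values with χ Q
      absorb (inj₁ ≡.refl)        | _ = Δ-zero d (Δ^ 1ℤ d k (Δ^ -1ℤ d l s)) n
      absorb (inj₂ (inj₁ ≡.refl)) | _ = ≡.refl
      absorb (inj₂ (inj₂ ≡.refl)) | _ = Δ-Δ^-comm -1ℤ d 1ℤ d k (Δ^ -1ℤ d l s) n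

  Σ-χ : ∀ Qs → Σ[ χ ] Qs ≡ + length (with-value 1ℤ Qs) ℤ.- + length (with-value -1ℤ Qs)
  Σ-χ [] = ≡.refl
  Σ-χ (Q ∷ Qs) = ≡.trans (cong (ℤ._+_ (χ Q)) (Σ-χ Qs)) (absorb (σ-values (eval Q u * eval Q v)))
    where
    k = length (with-value 1ℤ Qs)
    l = length (with-value -1ℤ Qs)

    absorb : χ Q ≡ 0ℤ ⊎ χ Q ≡ 1ℤ ⊎ χ Q ≡ -1ℤ →
             χ Q ℤ.+ (+ k ℤ.- + l) ≡ + length (with-value 1ℤ (Q ∷ Qs)) ℤ.- + length (with-value -1ℤ (Q ∷ Qs))
    absorb values with χ Q
    absorb (inj₁ ≡.refl)        | _ = ℤₚ.+-identityˡ _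
    absorb (inj₂ (inj₁ ≡.refl)) | _ = ≡.sym (ℤₚ.+-assoc 1ℤ (+ k) (ℤ.- + l))
    absorb (inj₂ (inj₂ ≡.refl)) | _ = lemma (+ k) (+ l)
      where
      lemma : ∀ k l → -1ℤ ℤ.+ (k ℤ.- l) ≡ k ℤ.- (1ℤ ℤ.+ l)
      lemma = solve-∀

  -- These are indexed by the degree itself, whereas `irreducibles m` holds degree m + 1; there are
  -- no irreducibles of degree 0.
  positives negatives : ℕ → ℕ
  positives zero    = 0
  positives (suc m) = length (with-value 1ℤ (irreducibles m))
  negatives zero    = 0
  negatives (suc m) = length (with-value -1ℤ (irreducibles m))

  G : ℕ → Sequence
  G m = roughSum (irreducibles≤ m)

  G-suc : ∀ m → G (suc m) ≗ Δ^ 1ℤ (suc m) (positives (suc m)) (Δ^ -1ℤ (suc m) (negatives (suc m)) (G m))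
  G-suc m = roughSum-++ m (irreducibles m) (irreducibles! m) (irreducibles-monic m)
    (irreducibles-unsplittable m) (irreducibles-rough m)

  -- The rough monics of degree m + 1 are by definition the list `irreducibles m`, so the
  -- coefficient is a sum of χ over irreducibles.
  G-next : ∀ m → G m (suc m) ≡ + positives (suc m) ℤ.- + negatives (suc m)
  G-next m = Σ-χ (irreducibles m)

-- The L-series of χ and the cardinalities of C and D

module Counting {q c ℓ} (𝔽 : FiniteField q c ℓ) (2∤q : 2 ∤ q) (u v : FiniteField.Carrier 𝔽)
         (u≉v : ¬ FiniteField._≈_ 𝔽 u v) where

  open FiniteField 𝔽
  open RingProperties ring
  open Polynomial commutativeRing
  open PolynomialRing commutativeRing
  open Degree commutativeRing
  open FiniteFieldPolynomials 𝔽
  open QuadraticCharacter 𝔽 2∤q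
  open MonicPolynomials 𝔽 2∤q
  open Sieve 𝔽 2∤q u v
  open Membership polySetoid using (_∈_)
  open Unique polySetoid using (Unique)
  open Permutation polySetoid using (_↭_)
  open UniqueLists polySetoid using (Σ-↭; unique-⊆∧length⇒↭; enumeration-cardinality)

  private
    module Pₚ = RingProperties (CommutativeRing.ring polyCommutativeRing)

  Σ-monics-0 : Σ[ χ ] (monics 0) ≡ 1ℤ
  Σ-monics-0 = cong (ℤ._+ 0ℤ) (≡.trans (σ-cong (trans (*-cong (1+x0 u) (1+x0 v)) (*-identityˡ 1#))) σ-1)
    where
    1+x0 : ∀ x → 1# + x * 0# ≈ 1#
    1+x0 x = trans (+-congˡ (zeroʳ x)) (+-identityʳ 1#)

  eval-x+a : ∀ a x → eval (a ∷ 1# ∷ []) x ≈ a + x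
  eval-x+a a x = +-congˡ (trans (*-congˡ (trans (+-congˡ (zeroʳ x)) (+-identityʳ 1#))) (*-identityʳ x))

  x-_ : Carrier → Poly
  x- w = - w ∷ 1# ∷ []

  x-w-monic : ∀ w → MonicOfDegree 1 (x- w)
  x-w-monic w = refl , λ { (suc (suc i)) _ → refl ; (suc zero) (s≤s ()) }

  eval-x-w : ∀ w x → eval (x- w) x ≈ x - w
  eval-x-w w x = trans (eval-x+a (- w) x) (+-comm (- w) x)

  v-u≉0 : ¬ v - u ≈ 0#
  v-u≉0 v-u≈0 = u≉v (sym (x∙y⁻¹≈ε⇒x≈y v u v-u≈0))

  -- The values of x + a at u and v are b = a + u and b + (v - u). As `a` runs through the field so
  -- does b, and u ≠ v makes the shift nonzero.
  Σ-monics-1 : Σ[ χ ] (monics 1) ≡ -1ℤ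
  Σ-monics-1 = begin
    Σ[ χ ] (monics 1)
      ≡⟨ Σ-cartesianProductWith-[-] χ _∷_ elements (1# ∷ []) ⟩
    Σ[ (λ a → χ (a ∷ 1# ∷ [])) ] elements
      ≡⟨ Σ-cong elements (All.universal (λ a → σ-cong (*-cong (eval-x+a a u) (shifted a))) elements) ⟩
    Σ[ (λ a → ψ (a + u)) ] elements            ≡⟨ Σ-map ψ (_+ u) elements ⟨
    Σ[ ψ ] (map (_+ u) elements)
      ≡⟨ UniqueLists.Σ-↭ setoid ψ ψ-cong (injective⇒↭ (_+ u) (+-cancelʳ u _ _)) ⟩
    Σ[ ψ ] elements                            ≡⟨ Σ-σ-shifted v-u≉0 ⟩
    -1ℤ                                        ∎
    where
    open ≡.≡-Reasoning
    ψ : Carrier → ℤ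
    ψ b = σ (b * (b + (v - u)))
    ψ-cong : ∀ {a b} → a ≈ b → ψ a ≡ ψ b
    ψ-cong a≈b = σ-cong (*-cong a≈b (+-congʳ a≈b))
    shifted : ∀ a → eval (a ∷ 1# ∷ []) v ≈ a + u + (v - u)
    shifted a = trans (eval-x+a a v) (trans (+-congˡ (sym (trans (+-congˡ (+-comm v (- u))) (trans (sym (+-assoc u (- u) v))
      (trans (+-congʳ (-‿inverseʳ u)) (+-identityˡ v)))))) (sym (+-assoc a u (v - u))))

  -- f ↦ f + s(f) (x - v), with s(f) = (g - 1) f(u) / (u - v), multiplies f(u) by the
  -- non-residue g and fixes f(v).
  private
    ∃[u-v]⁻¹ : ∃ λ r → (u - v) * r ≈ 1#
    ∃[u-v]⁻¹ = inverse (u - v) λ u-v≈0 → u≉v (x∙y⁻¹≈ε⇒x≈y u v u-v≈0)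

    s : Carrier → Carrier
    s a = (proj₁ ∃[u-v]⁻¹ * (g - 1#)) * a

    twist : Poly → Poly
    twist f = f +ₚ s (eval f u) ·ₚ x- v

    eval-twist : ∀ f x → eval (twist f) x ≈ eval f x + s (eval f u) * (x - v)
    eval-twist f x = trans (eval-+ f (s (eval f u) ·ₚ x- v) x)
      (+-congˡ (trans (eval-· (s (eval f u)) (x- v) x) (*-congˡ (eval-x-w v x))))

    eval-twist-u : ∀ f → eval (twist f) u ≈ g * eval f u
    eval-twist-u f = begin
      eval (twist f) u                       ≈⟨ eval-twist f u ⟩
      a + ((r * (g - 1#)) * a) * (u - v)
        ≈⟨ +-congˡ (solve 4 (λ r h a w → ((r :* h) :* a) :* w := (w :* r) :* (h :* a)) refl r (g - 1#) a (u - v)) ⟩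
      a + ((u - v) * r) * ((g - 1#) * a)
        ≈⟨ +-congˡ (trans (*-congʳ (proj₂ ∃[u-v]⁻¹)) (*-identityˡ _)) ⟩
      a + (g - 1#) * a                       ≈⟨ +-cong (sym (*-identityˡ a)) refl ⟩
      1# * a + (g - 1#) * a                  ≈⟨ distribʳ a 1# (g - 1#) ⟨
      (1# + (g - 1#)) * a
        ≈⟨ *-congʳ (trans (sym (+-assoc 1# g (- 1#))) (xyx⁻¹≈y 1# g)) ⟩
      g * a                                  ∎
      where
      open ≈-Reasoning setoid
      open RingSolver commutativeSemiring
      a = eval f u
      r = proj₁ ∃[u-v]⁻¹

    eval-twist-v : ∀ f → eval (twist f) v ≈ eval f v
    eval-twist-v f = trans (eval-twist f v) (trans (+-congˡ (trans (*-congˡ (-‿inverseʳ v)) (zeroʳ _))) (+-identityʳ _))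

    χ-twist : ∀ f → χ (twist f) ≡ -1ℤ ℤ.* χ f
    χ-twist f = ≡.trans (σ-cong (trans (*-cong (eval-twist-u f) (eval-twist-v f)) (*-assoc g _ _)))
      (≡.trans (σ-g* _) (≡.sym (ℤₚ.-1*i≡-i (χ f))))

    -- The twist determines g f(u), hence f(u), hence the multiple of x - v that was added.
    twist-injective : ∀ {f h} → twist f ≈ₚ twist h → f ≈ₚ h
    twist-injective {f} {h} e = Pₚ.+-cancelʳ (s (eval h u) ·ₚ x- v) f h λ i → trans
      (+ₚ-cong {f} {f} {s (eval h u) ·ₚ x- v} {s (eval f u) ·ₚ x- v} (λ _ → refl)
        (·-cong {s (eval h u)} {s (eval f u)} {x- v} {x- v} (*-congˡ (sym fu≈hu)) (λ _ → refl)) i)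
      (e i)
      where
      fu≈hu : eval f u ≈ eval h u
      fu≈hu = *-cancel g≉0 (trans (sym (eval-twist-u f)) (trans (eval-cong {twist f} {twist h} u e) (eval-twist-u h)))

    -- Only the coefficients at 0 and 1 are changed; in degree 1 the leading coefficient would be
    -- among them.
    twist-monic : ∀ {n} f → 2 ≤ n → MonicOfDegree n f → MonicOfDegree n (twist f)
    twist-monic {n} f 2≤n (top , f<n) = trans (higher n 2≤n) top ,
      λ i n<i → trans (higher i (ℕₚ.≤-trans 2≤n (ℕₚ.<⇒≤ n<i))) (f<n i n<i)
      where
      t = s (eval f u)
      higher : ∀ i → 2 ≤ i → coeff (twist f) i ≈ coeff f i
      higher (suc (suc i)) (s≤s (s≤s _)) = trans (coeff-+ f (t ·ₚ x- v) (suc (suc i))) (+-identityʳ _)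

    twist-↭ : ∀ n → 2 ≤ n → map twist (monics n) ↭ monics n
    twist-↭ n 2≤n = unique-⊆∧length⇒↭
      (Uniqueₚ.map⁺ polySetoid polySetoid (λ {f} {h} → twist-injective {f} {h}) (monics! n))
      (Allₚ.map⁺ (All.map (λ {f} f-monic → ∈-monics (twist f) (twist-monic f 2≤n f-monic)) (monics-monic n)))
      (ℕₚ.≤-reflexive (≡.sym (List.length-map twist (monics n))))

  Σ-monics-≥2 : ∀ n → 2 ≤ n → Σ[ χ ] (monics n) ≡ 0ℤ
  Σ-monics-≥2 n 2≤n = x≡-x⇒x≡0 _ (begin
    Σ[ χ ] (monics n)                       ≡⟨ Σ-↭ χ (λ {f} {h} → χ-cong {f} {h}) (twist-↭ n 2≤n) ⟨
    Σ[ χ ] (map twist (monics n))           ≡⟨ Σ-map χ twist (monics n) ⟩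
    Σ[ (λ f → χ (twist f)) ] (monics n)
      ≡⟨ Σ-cong (monics n) (All.universal χ-twist (monics n)) ⟩
    Σ[ (λ f → -1ℤ ℤ.* χ f) ] (monics n)     ≡⟨ Σ-*ˡ -1ℤ χ (monics n) ⟩
    -1ℤ ℤ.* Σ[ χ ] (monics n)               ≡⟨ ℤₚ.-1*i≡-i _ ⟩
    ℤ.- Σ[ χ ] (monics n)                   ∎)
    where open ≡.≡-Reasoning

  G-zero : G 0 ≗ Δ 1ℤ 1 δ
  G-zero n = ≡.trans (cong Σ[ χ ] (List.filter-all (rough? []) (All.universal (λ _ → []) (monics n)))) (go n)
    where
    go : ∀ n → Σ[ χ ] (monics n) ≡ Δ 1ℤ 1 δ n
    go 0             = Σ-monics-0
    go 1             = Σ-monics-1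
    go (suc (suc n)) = Σ-monics-≥2 (suc (suc n)) (s≤s (s≤s z≤n))

  -- By the factor theorem a root would make x - w a proper factor. Hence χ is nonzero on
  -- irreducibles of degree at least 2.
  no-root : ∀ {m} P w → 1 ≤ m → MonicOfDegree (suc m) P → Unsplittable P → ¬ eval P w ≈ 0#
  no-root {m} P w 1≤m P-monic P-unsplit Pw≈0 with k , r , P≈Lk+r , r<1 ← divMod (x- w) (x-w-monic w) P =
    contradiction (P-unsplit L k (x-w-monic w) (proj₂ (proj₂ cofactor)) Lk≈P) trivial
    where
    open ≈-Reasoning setoid
    L = x- w
    r≈[r₀] : r ≈ₚ coeff r 0 ∷ []
    r≈[r₀] zero    = refl
    r≈[r₀] (suc i) = r<1 (suc i) (s≤s z≤n)
    r₀≈0 : coeff r 0 ≈ 0#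
    r₀≈0 = begin
      coeff r 0                           ≈⟨ trans (+-congˡ (zeroʳ w)) (+-identityʳ _) ⟨
      eval (coeff r 0 ∷ []) w             ≈⟨ eval-cong {r} {coeff r 0 ∷ []} w r≈[r₀] ⟨
      eval r w                            ≈⟨ +-identityˡ _ ⟨
      0# + eval r w
        ≈⟨ +-congʳ (trans (eval-* L k w) (trans (*-congʳ (trans (eval-x-w w w) (-‿inverseʳ w))) (zeroˡ _))) ⟨
      eval (L *ₚ k) w + eval r w          ≈⟨ eval-+ (L *ₚ k) r w ⟨
      eval (L *ₚ k +ₚ r) w                ≈⟨ eval-cong {P} {L *ₚ k +ₚ r} w P≈Lk+r ⟨
      eval P w                            ≈⟨ Pw≈0 ⟩
      0#                                  ∎
    r≈0 : r ≈ₚ []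
    r≈0 zero    = r₀≈0
    r≈0 (suc i) = r<1 (suc i) (s≤s z≤n)
    Lk≈P : L *ₚ k ≈ₚ P
    Lk≈P = +ₚ-≈[] {P} {L *ₚ k} {r} P≈Lk+r r≈0
    cofactor = monic-cofactor L k P (x-w-monic w) P-monic Lk≈P
    trivial : ¬ (1 ≡ 0 ⊎ proj₁ cofactor ≡ 0)
    trivial (inj₂ e≡0) = ℕₚ.<⇒≢ (s≤s 1≤m) (≡.trans (cong suc (≡.sym e≡0)) (proj₁ (proj₂ cofactor)))

  private
    module _ {m : ℕ} {x : ℤ} where

      with-value! : Unique (with-value x (irreducibles m))
      with-value! = Uniqueₚ.filter⁺ polySetoid (λ f → χ f ℤₚ.≟ x) (irreducibles! m)

      with-value-sound : All (λ f → 𝓘 𝔽 (suc m) f × Unsplittable f × χ f ≡ x) (with-value x (irreducibles m))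
      with-value-sound = All.zipWith
        (λ {f} ((f-monic , f-unsplit) , χf≡x) →
          (f-monic , unsplittable⇒irreducible f f-monic (λ {a} {b} → f-unsplit {a} {b})) , (λ {a} {b} → f-unsplit {a} {b}) , χf≡x)
        ( Allₚ.filter⁺ (λ f → χ f ℤₚ.≟ x) (All.zip (irreducibles-monic m , irreducibles-unsplittable m))
        , Allₚ.all-filter (λ f → χ f ℤₚ.≟ x) (irreducibles m))

      ∈-with-value : ∀ f → 𝓘 𝔽 (suc m) f → χ f ≡ x → f ∈ with-value x (irreducibles m)
      ∈-with-value f (f-monic , f-irr) χf≡x = Membershipₚ.∈-filter⁺ polySetoid (λ f → χ f ℤₚ.≟ x)
        (λ {f} {h} f≈h → ≡.trans (≡.sym (χ-cong {f} {h} f≈h))) {v = f}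
        (∈-irreducibles f f-monic (irreducible⇒rough f f-monic f-irr)) χf≡x

  -- Degree 1 is included, because the case n = 2 refers to C in degree n / 2 = 1.
  C-cardinality : ∀ m → PolyCard 𝔽 (C 𝔽 u v (suc m)) (negatives (suc m))
  C-cardinality m = enumeration-cardinality (with-value! {m})
    (All.map (λ {f} (f-irr , _ , χf≡-1) → f-irr , σ≡-1⇒legendre _ χf≡-1) with-value-sound)
    (λ {f} (f-irr , leg≈-1) → ∈-with-value f f-irr (legendre⇒σ≡-1 leg≈-1))

  -- As a complement, D comprises χ = 0 as well as χ = 1; in degree at least 2 the former is
  -- excluded by `no-root`.
  D-cardinality : ∀ m → 1 ≤ m → PolyCard 𝔽 (D 𝔽 u v (suc m)) (positives (suc m))
  D-cardinality m 1≤m = enumeration-cardinality (with-value! {m})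
    (All.map (λ {f} (f-irr , _ , χf≡1) → f-irr , λ (_ , leg≈-1) → 1≢-1 (≡.trans (≡.sym χf≡1) (legendre⇒σ≡-1 leg≈-1))) with-value-sound)
    (λ {f} (f-irr , f∉C) → ∈-with-value f f-irr (positive f f-irr f∉C (σ-values (eval f u * eval f v))))
    where
    1≢-1 : ¬ 1ℤ ≡ -1ℤ
    1≢-1 ()

    positive : ∀ f → 𝓘 𝔽 (suc m) f → ¬ C 𝔽 u v (suc m) f → χ f ≡ 0ℤ ⊎ χ f ≡ 1ℤ ⊎ χ f ≡ -1ℤ → χ f ≡ 1ℤ
    positive f (f-monic , f-irr) f∉C (inj₁ χf≡0) = contradiction χf≡0
      (σ≢0 (*-≉0 (no-root f u 1≤m f-monic f-unsplit) (no-root f v 1≤m f-monic f-unsplit)))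
      where
      f-unsplit : Unsplittable f
      f-unsplit {a} {b} = rough⇒unsplittable f f-monic (irreducible⇒rough f f-monic f-irr) {a} {b}
    positive f f-irr f∉C (inj₂ (inj₁ χf≡1))  = χf≡1
    positive f f-irr f∉C (inj₂ (inj₂ χf≡-1)) = contradiction (f-irr , σ≡-1⇒legendre _ χf≡-1) f∉C

  open EulerProduct G positives negatives G-zero G-suc G-next using (c≡p-odd; c≡p-even)

  odd-difference : ∀ n → 2 ≤ n → 2 ∤ n → + negatives n ℤ.- + positives n ≡ 0ℤ
  odd-difference n 2≤n 2∤n with odd⇒1+double 2∤n
  -- Degree 1 is a true exception: there the difference is 1, from the L-series 1 - T.
  odd-difference _ (s≤s ()) 2∤n | zero  , ≡.refl
  odd-difference _ 2≤n      2∤n | suc k , ≡.refl = ℤₚ.i≡j⇒i-j≡0 (cong +_ (c≡p-odd k))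

  even-difference : ∀ n → 2 ≤ n → 2 ∣ n →
                    ∃ λ e → PolyCard 𝔽 (C 𝔽 u v (n / 2)) e × + negatives n ℤ.- + positives n ≡ + e
  even-difference _ ()  (divides zero ≡.refl)
  even-difference _ 2≤n (divides (suc k) ≡.refl) = negatives (suc k) ,
    ≡.subst (λ m → PolyCard 𝔽 (C 𝔽 u v m) (negatives (suc k))) (≡.sym (m*n/n≡m (suc k) 2)) (C-cardinality k) ,
    ≡.subst (λ n → + negatives n ℤ.- + positives n ≡ + negatives (suc k)) double≡*2 (begin
      + negatives n ℤ.- + positives n
        ≡⟨ cong (λ x → + x ℤ.- + positives n) (c≡p-even k) ⟩
      (+ positives n ℤ.+ + negatives (suc k)) ℤ.- + positives n
        ≡⟨ lemma (+ positives n) (+ negatives (suc k)) ⟩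
      + negatives (suc k)                                    ∎)
    where
    open ≡.≡-Reasoning
    n = double (suc k)
    lemma : ∀ a b → (a ℤ.+ b) ℤ.- a ≡ b
    lemma = solve-∀
    double≡*2 : n ≡ suc k ℕ.* 2
    double≡*2 = ≡.trans (cong (suc k ℕ.+_) (≡.sym (ℕₚ.+-identityʳ (suc k)))) (ℕₚ.*-comm 2 (suc k))

open import Data.Integer.Base using (_-_)

theorem3 : ∀ {a ℓ} (q : ℕ) → OddPrimePower q → (𝔽 : FiniteField q a ℓ) →
    (u v : FiniteField.Carrier 𝔽) → ¬ FiniteField._≈_ 𝔽 u v → (n : ℕ) → 2 ≤ n →
    ∃₂ λ c d → PolyCard 𝔽 (C 𝔽 u v n) c × PolyCard 𝔽 (D 𝔽 u v n) d ×
    (2 ∤ n → + c - + d ≡ 0ℤ) ×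
    (2 ∣ n → ∃ λ e → PolyCard 𝔽 (C 𝔽 u v (n / 2)) e × + c - + d ≡ + e)
theorem3 q (_ , 2∤q) 𝔽 u v u≉v (suc m) 2≤n@(s≤s 1≤m) =
  negatives (suc m) , positives (suc m) , C-cardinality m , D-cardinality m 1≤m ,
  odd-difference (suc m) 2≤n , even-difference (suc m) 2≤n
  where
  open Sieve 𝔽 2∤q u v
  open Counting 𝔽 2∤q u v u≉v
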